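{- Let $p>2$ be a prime, let $t$ be a positive divisor of $p-1$, let $k$ be an integer with $1<k\le (p/2)^{1/2}$, and let $a\in\mathbb{F}_p^*$. Put $r_1(k)=\left\lfloor \frac{\log(p/2)}{2\log k}\right\rfloor$ and $s=s_1(k,t)=\max\left\{s'\in\mathbb{Z}_{\ge0}~:~\binom{r_1(k)+s'}{s'}\le t\right\}$. Then $$\#\{|x|~:~x\in V(k,t,a)\}\le\tilde\Phi(k,s+1).$$
   Context: $\mathbb{F}_p$ is the field of residues modulo $p$. For $x\in\mathbb{F}_p$, the integer height is $|x|=\min\{|a|~:~a\in\mathbb{Z},\ a\equiv x\pmod p\}$ and the rational height is $\|x\|=\min\{\max(|a|,b)~:~a\in\mathbb{Z},\ b\in\mathbb{N},\ a\equiv bx \pmod p\}$. For $t\mid p-1$, $G$ is the unique subgroup of $\mathbb{F}_p^*$ of order $t$, $aG=\{ag:g\in G\}$, and $V(k,t,a)=\{x\in aG~:~\|x\|\le k\}$. $\Psi(x,y)$ is the number of positive integers $n\le x$ all of whose prime factors are at most $y$; $p_j$ is the $j$-th prime ($p_1=2$), with the convention $\Psi(x,p_0)=1$ for $x\ge 1$. For $s\in\mathbb{N}$, $\tilde\Phi(k,s)=\sum_{i=0}^{s}\binom{s}{i}\Psi(k,p_i)\Psi(k,p_{s-i})$, and $\tilde\Phi(k,0)=1$. -}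

module Defs where

open import Data.Nat using (ℕ; zero; suc; _+_; _*_; _∸_; _^_; _≤_; _<_; _!)
open import Data.Nat.Combinatorics using (_C_)
open import Data.Nat.Primality using (Prime; prime?)
open import Data.Nat.Divisibility using (_∣?_)
open import Data.Nat.Properties using (_≤?_)
open import Data.Integer using (ℤ; +_; _-_; ∣_∣)
import Data.Integer.Divisibility as ℤdiv
open import Data.List using (List; []; _∷_; upTo; map; filter; length)
open import Data.Nat.ListAction using (sum)
open import Data.Bool.ListAction using (all)
open import Data.Bool using (Bool; true; false; _∧_; not; _∨_)
open import Data.Product using (Σ; _×_; ∃; ∃-syntax)
open import Relation.Nullary.Decidable using (isYes; ⌊_⌋)
open import Relation.Nullary.Decidable using (T?)
open import Relation.Binary.PropositionalEquality using (_≡_)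

_≡_[mod_] : ℤ → ℤ → ℕ → Set
a ≡ b [mod p ] = (+ p) ℤdiv.∣ (a - b)

range : ℕ → ℕ → List ℕ
range m n = map (λ i → m + i) (upTo n)

firstWith : (ℕ → Bool) → ℕ → List ℕ → ℕ
firstWith f d []       = d
firstWith f d (x ∷ xs) with f x
... | true  = x
... | false = firstWith f d xs

-- the least prime > n; searched in (n, n! + 1], which contains a prime (Euclid)
nextPrime : ℕ → ℕ
nextPrime n = firstWith (λ q → ⌊ prime? q ⌋) (n ! + 1) (range (suc n) (n !))

-- p_j, the j-th prime (p_1 = 2).  We set p_0 = 1, so that Ψ(x, p_0) = 1 for x ≥ 1,
-- which is exactly the paper's convention.
nthPrime : ℕ → ℕ
nthPrime zero    = 1
nthPrime (suc j) = nextPrime (nthPrime j)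

-- n (≥ 1) is y-smooth: every prime q dividing n satisfies q ≤ y
-- (prime divisors of n ≥ 1 are ≤ n, so checking q ∈ [0, n] suffices)
smooth : ℕ → ℕ → Bool
smooth y n = all (λ q → not (⌊ prime? q ⌋ ∧ ⌊ q ∣? n ⌋) ∨ ⌊ q ≤? y ⌋) (upTo (suc n))

Ψ : ℕ → ℕ → ℕ
Ψ x y = length (filter (λ n → T? (smooth y n)) (range 1 x))

-- Φ̃(k, s) = Σ_{i=0}^{s} C(s,i) Ψ(k,p_i) Ψ(k,p_{s-i})   (equals 1 for s = 0 since Ψ(k,p_0)=1)
Φ̃ : ℕ → ℕ → ℕ
Φ̃ k s = sum (map (λ i → (s C i) * Ψ k (nthPrime i) * Ψ k (nthPrime (s ∸ i))) (upTo (suc s)))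

-- x ∈ G, G = {g ∈ F_p^* : g^t = 1}, the unique subgroup of order t of F_p^* (t ∣ p-1)
InG : ℕ → ℕ → ℕ → Set
InG p t g = (g < p) × ((+ (g ^ t)) ≡ (+ 1) [mod p ])

InCoset : ℕ → ℕ → ℕ → ℕ → Set
InCoset p t a x = ∃[ g ] (InG p t g × ((+ x) ≡ (+ (a * g)) [mod p ]))

RatHeightLe : ℕ → ℕ → ℕ → Set
RatHeightLe p k x = ∃[ A ] ∃[ b ] ((1 ≤ b) × (b ≤ k) × (∣ A ∣ ≤ k) × (A ≡ (+ (b * x)) [mod p ]))

-- x ∈ V(k,t,a), with F_p represented by {0, ..., p-1}
InV : ℕ → ℕ → ℕ → ℕ → ℕ → Set
InV p k t a x = (x < p) × InCoset p t a x × RatHeightLe p k x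

IsIntHeight : ℕ → ℕ → ℕ → Set
IsIntHeight p x h =
  (∃[ A ] ((∣ A ∣ ≡ h) × (A ≡ (+ x) [mod p ]))) × (∀ (A : ℤ) → A ≡ (+ x) [mod p ] → h ≤ ∣ A ∣)

-- R1 p k r : r = r_1(k) = ⌊ log(p/2) / (2 log k) ⌋, i.e. r is the largest natural
-- number with k^(2r) ≤ p/2 (equivalently 2 k^(2r) ≤ p)
IsR1 : ℕ → ℕ → ℕ → Set
IsR1 p k r = (2 * k ^ (2 * r) ≤ p) × (∀ r′ → 2 * k ^ (2 * r′) ≤ p → r′ ≤ r)

IsS1 : ℕ → ℕ → ℕ → Set
IsS1 r t s = (((r + s) C s) ≤ t) × (∀ s′ → ((r + s′) C s′) ≤ t → s′ ≤ s)

{-# OPTIONS --safe #-}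
-- Write the elements of V(k,t,a) as fractions A/b with |A|, b ≤ k.  If s + 2 of the positive
-- rationals |A|/b were multiplicatively independent, their C(r+s+1,s+1) > t monomials of degree r
-- would be distinct rationals of height at most k^r; since 2k^(2r) < p they stay distinct
-- modulo p.  But they all solve X^t = a^(tr), which has at most t solutions.  So the
-- exponent vectors have rank at most s + 1, and Gaussian elimination yields at most s + 1 primes
-- q₁ < q₂ < ... whose exponents determine |A|/b, hence |x|.  Split these primes according to the
-- sign of the exponent, and replace the i primes occurring in the numerator by p₁, ..., p_i and the
-- others likewise: this maps the heights injectively to sign patterns with two smooth numbers ≤ k,
-- and there are at most Φ̃(k,s+1) of these.
module Submission where

open import Defs
open import Algebra.Bundles using (AbelianGroup)
open import Data.Bool using (Bool; true; false; T; not; _∧_; _∨_)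
open import Data.Empty using (⊥-elim)
open import Data.Integer as ℤ using (ℤ; +_; -[1+_]; ∣_∣)
open import Data.Integer.Divisibility.Signed as Signed using (∣ᵤ⇒∣; ∣⇒∣ᵤ)
import Data.Integer.Properties as ℤ
open import Data.Integer.Tactic.RingSolver using (solve-∀)
open import Data.List using (List; []; _∷_; _++_; length; map; filter; upTo; cartesianProduct)
open import Data.List.Membership.Propositional using (_∈_)
open import Data.List.Membership.Propositional.Properties using (∈-∃++; ∈-++⁻; ∈-++⁺ˡ; ∈-++⁺ʳ; ∈-map⁺; ∈-map⁻; ∈-upTo⁺; ∈-upTo⁻; ∈-filter⁺; ∈-filter⁻; ∈-cartesianProduct⁺)
open import Data.List.Properties using (length-++; length-map; filter-++; filter-accept; filter-reject; map-applyUpTo; ∷-injectiveˡ; ∷-injectiveʳ)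
open import Data.List.Relation.Binary.Permutation.Propositional using (_↭_)
open import Data.List.Relation.Binary.Permutation.Propositional.Properties using (↭-length; filter-↭; shift)
open import Data.List.Relation.Binary.Sublist.Propositional using (_⊆_; []; _∷_; _∷ʳ_)
open import Data.List.Relation.Binary.Sublist.Propositional.Properties using (All-resp-⊆)
open import Data.List.Relation.Unary.All as All using (All; []; _∷_)
import Data.List.Relation.Unary.All.Properties as All
open import Data.List.Relation.Unary.AllPairs as AllPairs using (AllPairs; []; _∷_)
import Data.List.Relation.Unary.AllPairs.Properties as AllPairs
open import Data.List.Relation.Unary.Any using (here; there; any?; satisfied)
open import Data.List.Relation.Unary.Unique.Propositional using (Unique)
import Data.List.Relation.Unary.Unique.Propositional.Properties as Unique
open import Data.Nat using (ℕ; zero; suc; _+_; _*_; _∸_; _^_; _≤_; _<_; z≤n; s≤s; NonZero; >-nonZero; >-nonZero⁻¹; nonTrivial⇒n>1; _!)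
open import Data.Nat.Combinatorics using (_C_; nCk+nC[k+1]≡[n+1]C[k+1]; nCn≡1; k>n⇒nCk≡0)
open import Data.Nat.Divisibility using (_∣_)
import Data.Nat.Divisibility as ℕ
open import Data.Nat.ListAction using (sum; product)
open import Data.Nat.ListAction.Properties using (product-++; product-↭; ∈⇒∣product)
open import Data.Nat.Primality using (Prime; prime?; euclidsLemma; ¬prime[1]; prime⇒nonZero; prime⇒nonTrivial; prime⇒irreducible)
open import Data.Nat.Primality.Factorisation using (PrimeFactorisation; factors; factorise; factorisationUnique)
import Data.Nat.Properties as ℕ
open import Data.Product using (_×_; _,_; ∃-syntax; proj₁; proj₂)
open import Data.Sum using (_⊎_; inj₁; inj₂)
open import Data.Unit using (tt)
open import Data.Vec as Vec using (Vec; []; _∷_)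
open import Data.Vec.Relation.Unary.All as AllV using ([]; _∷_)
open import Function using (_∘_)
open import Relation.Binary.PropositionalEquality
open import Relation.Nullary using (¬_; yes; no; contradiction; ¬?)
open import Relation.Nullary.Decidable using (T?; toWitness; fromWitness; ⌊_⌋; decidable-stable)
open import Algebra.Properties.CommutativeSemigroup ℕ.+-commutativeSemigroup using (interchange)
open import Algebra.Properties.Group (AbelianGroup.group ℤ.+-0-abelianGroup) as ℤ+ using ()
open import Data.List.Membership.DecPropositional ℕ._≟_ using (_∈?_)

open PrimeFactorisation using (isFactorisation; factorsPrime)

-- Exponents do not see the sign of A, and neither direction suffers from this. If two monomials
-- agree modulo p, their cross products agree as signed integers, hence so do all valuations, and
-- independence of the exponents of |A|/b already forces equal monomials. Conversely, equal
-- exponents determine the residue up to sign, which the height |x| ignores. All arithmetic is done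
-- with cross products of integers. A cross product of two monomials of degree r is at most k^r *
-- k^r, which is where the 2r in the definition of r_1 comes from. Fractions are not put into lowest
-- terms: an exponent is a difference of valuations, and cancellation only lowers the sizes. The
-- replacement of primes needs the pivot columns in ascending order: then the i-th prime used on
-- either side is at least p_i, so neither product grows.

pigeonhole : {A B : Set} (R : A → B → Set) → (∀ {x x′ y} → R x y → R x′ y → x ≡ x′) →
  ∀ {xs} → Unique xs → ∀ ys → (∀ {x} → x ∈ xs → ∃[ y ] (y ∈ ys × R x y)) → length xs ≤ length ys
pigeonhole R inj [] ys f = z≤n
pigeonhole R inj {x ∷ xs} (x∉xs ∷ unique) ys f with f (here refl)
... | y , y∈ys , Rxy with ∈-∃++ y∈ys
... | ys₁ , ys₂ , refl = begin
  suc (length xs)              ≤⟨ s≤s (pigeonhole R inj unique (ys₁ ++ ys₂) avoid) ⟩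
  suc (length (ys₁ ++ ys₂))    ≡⟨ cong suc (length-++ ys₁) ⟩
  suc (length ys₁ + length ys₂) ≡⟨ ℕ.+-suc (length ys₁) (length ys₂) ⟨
  length ys₁ + suc (length ys₂) ≡⟨ length-++ ys₁ ⟨
  length (ys₁ ++ y ∷ ys₂)      ∎
  where
  open ℕ.≤-Reasoning
  avoid : ∀ {x′} → x′ ∈ xs → ∃[ y′ ] (y′ ∈ ys₁ ++ ys₂ × R x′ y′)
  avoid x′∈xs with f (there x′∈xs)
  ... | y′ , y′∈ys , Rx′y′ with ∈-++⁻ ys₁ y′∈ys
  ...   | inj₁ y′∈ys₁         = y′ , ∈-++⁺ˡ y′∈ys₁ , Rx′y′
  ...   | inj₂ (here refl)    = ⊥-elim (All.lookup x∉xs x′∈xs (inj Rxy Rx′y′))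
  ...   | inj₂ (there y′∈ys₂) = y′ , ∈-++⁺ʳ ys₁ y′∈ys₂ , Rx′y′

AllPairs-zip : {A : Set} {P : A → Set} {R S : A → A → Set} → (∀ {x y} → P x → P y → R x y → S x y) →
  ∀ {xs} → All P xs → AllPairs R xs → AllPairs S xs
AllPairs-zip f [] [] = []
AllPairs-zip f (px ∷ pxs) (rx ∷ rxs) =
  All.zipWith (λ (py , r) → f px py r) (pxs , rx) ∷ AllPairs-zip f pxs rxs

-- Congruences and roots of polynomials

module Congruence (n : ℤ) where

  infix 4 _≈_
  -- A record rather than bare divisibility of `x - y`, so that both sides of a congruence can be
  -- recovered from its type.
  record _≈_ (x y : ℤ) : Set where
    constructor mod
    field difference : n Signed.∣ x ℤ.- y

  open _≈_ public

  ≈-reflexive : ∀ {x y} → x ≡ y → x ≈ y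
  ≈-reflexive {x} refl = mod (subst (n Signed.∣_) (sym (ℤ.+-inverseʳ x)) (Signed.divides (+ 0) refl))

  ≈-refl : ∀ {x} → x ≈ x
  ≈-refl = ≈-reflexive refl

  ≈-sym : ∀ {x y} → x ≈ y → y ≈ x
  ≈-sym {x} {y} (mod d) = mod (subst (n Signed.∣_) (eq x y) (Signed.∣m⇒∣-m d))
    where
    eq : ∀ x y → ℤ.- (x ℤ.- y) ≡ y ℤ.- x
    eq = solve-∀

  ≈-trans : ∀ {x y z} → x ≈ y → y ≈ z → x ≈ z
  ≈-trans {x} {y} {z} (mod d) (mod e) = mod (subst (n Signed.∣_) (eq x y z) (Signed.∣m∣n⇒∣m+n d e))
    where
    eq : ∀ x y z → (x ℤ.- y) ℤ.+ (y ℤ.- z) ≡ x ℤ.- z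
    eq = solve-∀

  *-cong : ∀ {x x′ y y′} → x ≈ x′ → y ≈ y′ → x ℤ.* y ≈ x′ ℤ.* y′
  *-cong {x} {x′} {y} {y′} (mod d) (mod e) =
    mod (subst (n Signed.∣_) (eq x x′ y y′) (Signed.∣m∣n⇒∣m+n (Signed.∣m⇒∣m*n y d) (Signed.∣n⇒∣m*n x′ e)))
    where
    eq : ∀ x x′ y y′ → (x ℤ.- x′) ℤ.* y ℤ.+ x′ ℤ.* (y ℤ.- y′) ≡ x ℤ.* y ℤ.- x′ ℤ.* y′
    eq = solve-∀

  *-congˡ : ∀ x {y y′} → y ≈ y′ → x ℤ.* y ≈ x ℤ.* y′
  *-congˡ x = *-cong {x} {x} ≈-refl

  *-congʳ : ∀ x {y y′} → y ≈ y′ → y ℤ.* x ≈ y′ ℤ.* x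
  *-congʳ x y≈y′ = *-cong y≈y′ (≈-refl {x})

  ^-cong : ∀ m {x y} → x ≈ y → x ℤ.^ m ≈ y ℤ.^ m
  ^-cong zero    e = ≈-refl
  ^-cong (suc m) e = *-cong e (^-cong m e)

  neg-cong : ∀ {x y} → x ≈ y → ℤ.- x ≈ ℤ.- y
  neg-cong {x} {y} (mod d) = mod (subst (n Signed.∣_) (eq x y) (Signed.∣m⇒∣-m d))
    where
    eq : ∀ x y → ℤ.- (x ℤ.- y) ≡ (ℤ.- x) ℤ.- (ℤ.- y)
    eq = solve-∀

euclidℤ : ∀ {p} → Prime p → ∀ x y → + p Signed.∣ x ℤ.* y → + p Signed.∣ x ⊎ + p Signed.∣ y
euclidℤ pr x y d with euclidsLemma ∣ x ∣ ∣ y ∣ pr (subst (_ ℕ.∣_) (ℤ.abs-* x y) (∣⇒∣ᵤ d))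
... | inj₁ e = inj₁ (∣ᵤ⇒∣ e)
... | inj₂ e = inj₂ (∣ᵤ⇒∣ e)

-- A polynomial is a function on the integers together with a derivation of its Horner form. No
-- coefficient list is needed, since division by a linear factor acts on the derivation itself.
data Monic : ℕ → (ℤ → ℤ) → Set where
  one    : ∀ {f} → (∀ x → f x ≡ + 1) → Monic 0 f
  horner : ∀ {n f g} → Monic n g → ∀ c → (∀ x → f x ≡ x ℤ.* g x ℤ.+ c) → Monic (suc n) f

-- Synthetic division: the coefficients of the quotient are the values at `a` of the inner Horner
-- polynomials.
divide-root : ∀ {n f} → Monic (suc n) f → ∀ a →
  ∃[ g ] (Monic n g × (∀ x → f x ≡ (x ℤ.- a) ℤ.* g x ℤ.+ f a))
divide-root {f = f} (horner {g = h} (one h≡1) c f≡) a = (λ _ → + 1) , one (λ _ → refl) , λ x → begin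
  f x                              ≡⟨ f≡ x ⟩
  x ℤ.* h x ℤ.+ c                  ≡⟨ cong (λ y → x ℤ.* y ℤ.+ c) (h≡1 x) ⟩
  x ℤ.* + 1 ℤ.+ c                  ≡⟨ eq x a c ⟩
  (x ℤ.- a) ℤ.* + 1 ℤ.+ (a ℤ.* + 1 ℤ.+ c) ≡⟨ cong (λ y → (x ℤ.- a) ℤ.* + 1 ℤ.+ (a ℤ.* y ℤ.+ c)) (h≡1 a) ⟨
  (x ℤ.- a) ℤ.* + 1 ℤ.+ (a ℤ.* h a ℤ.+ c) ≡⟨ cong (λ y → (x ℤ.- a) ℤ.* + 1 ℤ.+ y) (f≡ a) ⟨
  (x ℤ.- a) ℤ.* + 1 ℤ.+ f a        ∎
  where
  open ≡-Reasoning
  eq : ∀ x a c → x ℤ.* + 1 ℤ.+ c ≡ (x ℤ.- a) ℤ.* + 1 ℤ.+ (a ℤ.* + 1 ℤ.+ c)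
  eq = solve-∀
divide-root {f = f} (horner {g = h} m@(horner _ _ _) c f≡) a with divide-root m a
... | g , monic , h≡ = (λ x → x ℤ.* g x ℤ.+ h a) , horner monic (h a) (λ _ → refl) , λ x → begin
  f x                                                    ≡⟨ f≡ x ⟩
  x ℤ.* h x ℤ.+ c                                        ≡⟨ cong (λ y → x ℤ.* y ℤ.+ c) (h≡ x) ⟩
  x ℤ.* ((x ℤ.- a) ℤ.* g x ℤ.+ h a) ℤ.+ c                ≡⟨ eq x a c (g x) (h a) ⟩
  (x ℤ.- a) ℤ.* (x ℤ.* g x ℤ.+ h a) ℤ.+ (a ℤ.* h a ℤ.+ c) ≡⟨ cong (λ y → (x ℤ.- a) ℤ.* (x ℤ.* g x ℤ.+ h a) ℤ.+ y) (f≡ a) ⟨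
  (x ℤ.- a) ℤ.* (x ℤ.* g x ℤ.+ h a) ℤ.+ f a              ∎
  where
  open ≡-Reasoning
  eq : ∀ x a c g h → x ℤ.* ((x ℤ.- a) ℤ.* g ℤ.+ h) ℤ.+ c
                   ≡ (x ℤ.- a) ℤ.* (x ℤ.* g ℤ.+ h) ℤ.+ (a ℤ.* h ℤ.+ c)
  eq = solve-∀

module _ {p : ℕ} (pr : Prime p) where

  open Congruence (+ p)

  -- Lagrange's bound. Modulo p, a root `a` splits off a factor `x - a`; as p is prime, every root
  -- incongruent to `a` is a root of the quotient. Degree 0 leaves the constant 1, which has no root
  -- modulo p.
  roots≤degree : ∀ {n f} → Monic n f → ∀ {xs} →
    AllPairs (λ x y → ¬ y ≈ x) xs → All (λ x → + p Signed.∣ f x) xs → length xs ≤ n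
  roots≤degree m [] [] = z≤n
  roots≤degree (one f≡1) {x ∷ _} (_ ∷ _) (d ∷ _) =
    contradiction (subst Prime (ℕ.∣1⇒≡1 (∣⇒∣ᵤ (subst (+ p Signed.∣_) (f≡1 x) d))) pr) ¬prime[1]
  roots≤degree {f = f} m@(horner _ _ _) {a ∷ xs} (a∉xs ∷ distinct) (d ∷ ds) with divide-root m a
  ... | g , monic , f≡ = s≤s (roots≤degree monic distinct (All.zipWith quotient-root (a∉xs , ds)))
    where
    quotient-root : ∀ {x} → (¬ x ≈ a) × (+ p Signed.∣ f x) → + p Signed.∣ g x
    quotient-root {x} (x≉a , r)
      with euclidℤ pr (x ℤ.- a) (g x) (Signed.∣m+n∣n⇒∣m (subst (_ Signed.∣_) (f≡ x) r) d)
    ... | inj₁ d′ = contradiction (mod d′) x≉a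
    ... | inj₂ d′ = d′

^-monic : ∀ n → Monic n (λ x → x ℤ.^ n)
^-monic zero    = one (λ _ → refl)
^-monic (suc n) = horner (^-monic n) (+ 0) (λ x → sym (ℤ.+-identityʳ _))

^-minus-monic : ∀ n c → Monic (suc n) (λ x → x ℤ.^ suc n ℤ.- c)
^-minus-monic n c = horner (^-monic n) (ℤ.- c) (λ _ → refl)

-- Weak compositions

incr : ∀ {n} → Vec ℕ (suc n) → Vec ℕ (suc n)
incr (e ∷ es) = suc e ∷ es

-- The exponent vectors of the monomials of degree `r` in `n + 1` variables. Splitting by whether
-- the first exponent is zero or positive gives disjoint halves and turns Pascal's rule into the
-- count.
compositions : ∀ n → ℕ → List (Vec ℕ (suc n))
compositions zero    r       = (r ∷ []) ∷ []
compositions (suc n) zero    = Vec.replicate _ 0 ∷ []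
compositions (suc n) (suc r) = map (0 ∷_) (compositions n (suc r)) ++ map incr (compositions (suc n) r)

length-compositions : ∀ n r → length (compositions n r) ≡ (r + n) C n
length-compositions zero    r       = refl
length-compositions (suc n) zero    = sym (nCn≡1 (suc n))
length-compositions (suc n) (suc r) = begin
  length (compositions (suc n) (suc r))
    ≡⟨ length-++ (map (0 ∷_) (compositions n (suc r))) ⟩
  length (map (0 ∷_) (compositions n (suc r))) + length (map incr (compositions (suc n) r))
    ≡⟨ cong₂ _+_ (length-map _ (compositions n (suc r))) (length-map _ (compositions (suc n) r)) ⟩
  length (compositions n (suc r)) + length (compositions (suc n) r)
    ≡⟨ cong₂ _+_ (length-compositions n (suc r)) (length-compositions (suc n) r) ⟩
  (suc r + n) C n + (r + suc n) C suc n
    ≡⟨ cong (λ m → m C n + (r + suc n) C suc n) (sym (ℕ.+-suc r n)) ⟩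
  (r + suc n) C n + (r + suc n) C suc n
    ≡⟨ nCk+nC[k+1]≡[n+1]C[k+1] (r + suc n) n ⟩
  (suc r + suc n) C suc n ∎
  where open ≡-Reasoning

compositions-unique : ∀ n r → Unique (compositions n r)
compositions-unique zero    r       = [] ∷ []
compositions-unique (suc n) zero    = [] ∷ []
compositions-unique (suc n) (suc r) = Unique.++⁺
  (Unique.map⁺ ∷-injective (compositions-unique n (suc r)))
  (Unique.map⁺ incr-injective (compositions-unique (suc n) r))
  disjoint
  where
  ∷-injective : ∀ {m} {xs ys : Vec ℕ m} → 0 ∷ xs ≡ 0 ∷ ys → xs ≡ ys
  ∷-injective refl = refl
  incr-injective : ∀ {m} {xs ys : Vec ℕ (suc m)} → incr xs ≡ incr ys → xs ≡ ys
  incr-injective {xs = _ ∷ _} {ys = _ ∷ _} refl = refl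
  disjoint : ∀ {v} → ¬ (v ∈ map (0 ∷_) (compositions n (suc r)) × v ∈ map incr (compositions (suc n) r))
  disjoint (v∈₀ , v∈₁) with ∈-map⁻ (0 ∷_) v∈₀ | ∈-map⁻ incr v∈₁
  ... | _ , _ , refl | (_ ∷ _) , _ , ()

compositions-sum : ∀ n r → All (λ es → Vec.sum es ≡ r) (compositions n r)
compositions-sum zero    r       = ℕ.+-identityʳ r ∷ []
compositions-sum (suc n) zero    = sum-replicate (suc (suc n)) ∷ []
  where
  sum-replicate : ∀ m → Vec.sum (Vec.replicate m 0) ≡ 0
  sum-replicate zero    = refl
  sum-replicate (suc m) = sum-replicate m
compositions-sum (suc n) (suc r) = All.++⁺
  (All.map⁺ (compositions-sum n (suc r)))
  (All.map⁺ (All.map (λ { {_ ∷ _} eq → cong suc eq }) (compositions-sum (suc n) r)))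

-- Elimination

Σ· : ∀ {n} → Vec ℤ n → Vec ℤ n → ℤ
Σ· []       []       = + 0
Σ· (c ∷ cs) (v ∷ vs) = c ℤ.* v ℤ.+ Σ· cs vs

module _ {X : Set} where

  Independent : ∀ {n} → (X → ℕ → ℤ) → Vec X n → Set
  Independent v us = ∀ cs → (∀ q → Σ· cs (Vec.map (λ u → v u q) us) ≡ + 0) → AllV.All (_≡ + 0) cs

  -- The 2 by 2 minor of the rows `u`, `x` in the columns `q`, `j`: row `x` with its entry in column
  -- `q` cleared against row `u`, without division.
  pivot : (X → ℕ → ℤ) → X → ℕ → X → ℕ → ℤ
  pivot v u q x j = v u q ℤ.* v x j ℤ.- v x q ℤ.* v u j

  Σ·-pivot : ∀ v u q {n} (cs : Vec ℤ n) us j →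
    Σ· cs (Vec.map (λ x → pivot v u q x j) us) ≡
    v u q ℤ.* Σ· cs (Vec.map (λ x → v x j) us) ℤ.- Σ· cs (Vec.map (λ x → v x q) us) ℤ.* v u j
  Σ·-pivot v u q []       []       j = base (v u q) (v u j)
    where
    base : ∀ a b → + 0 ≡ a ℤ.* + 0 ℤ.- + 0 ℤ.* b
    base = solve-∀
  Σ·-pivot v u q (c ∷ cs) (x ∷ us) j =
    trans (cong (λ y → c ℤ.* pivot v u q x j ℤ.+ y) (Σ·-pivot v u q cs us j))
          (step (v u q) (v u j) c (v x j) (v x q) (Σ· cs (Vec.map (λ y → v y j) us)) (Σ· cs (Vec.map (λ y → v y q) us)))
    where
    step : ∀ a b c d e S T → c ℤ.* (a ℤ.* d ℤ.- e ℤ.* b) ℤ.+ (a ℤ.* S ℤ.- T ℤ.* b)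
                           ≡ a ℤ.* (c ℤ.* d ℤ.+ S) ℤ.- (c ℤ.* e ℤ.+ T) ℤ.* b
    step = solve-∀

  Σ·-zero : ∀ {n} {cs : Vec ℤ n} → AllV.All (_≡ + 0) cs → ∀ vs → Σ· cs vs ≡ + 0
  Σ·-zero []           []       = refl
  Σ·-zero (refl ∷ all) (v ∷ vs) = trans (ℤ.+-identityˡ _) (Σ·-zero all vs)

  -- A relation among the rows `u ∷ us` expresses the part over `us` in each column through `c`;
  -- combining the columns `j` and `q` eliminates `c` and leaves a relation among the pivoted rows.
  -- Once these coefficients vanish, column `q` forces `c` to vanish too.
  Independent-pivot : ∀ v u q → v u q ≢ + 0 → ∀ {n} (us : Vec X n) →
    Independent (pivot v u q) us → Independent v (u ∷ us)
  Independent-pivot v u q vuq≢0 us indep (c ∷ cs) zero-sum = c≡0 ∷ cs≡0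
    where
    open ≡-Reasoning
    S : ℕ → ℤ
    S j = Σ· cs (Vec.map (λ x → v x j) us)
    S≡ : ∀ j → S j ≡ ℤ.- (c ℤ.* v u j)
    S≡ j = ℤ+.∙-cancelˡ (c ℤ.* v u j) _ _ (trans (zero-sum j) (sym (ℤ.+-inverseʳ (c ℤ.* v u j))))
    cancel : ∀ a b c → a ℤ.* ℤ.- (c ℤ.* b) ℤ.- ℤ.- (c ℤ.* a) ℤ.* b ≡ + 0
    cancel = solve-∀
    cs≡0 : AllV.All (_≡ + 0) cs
    cs≡0 = indep cs λ j → begin
      Σ· cs (Vec.map (λ x → pivot v u q x j) us)  ≡⟨ Σ·-pivot v u q cs us j ⟩
      v u q ℤ.* S j ℤ.- S q ℤ.* v u j ≡⟨ cong₂ (λ x y → v u q ℤ.* x ℤ.- y ℤ.* v u j) (S≡ j) (S≡ q) ⟩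
      v u q ℤ.* ℤ.- (c ℤ.* v u j) ℤ.- ℤ.- (c ℤ.* v u q) ℤ.* v u j ≡⟨ cancel (v u q) (v u j) c ⟩
      + 0 ∎
    c*v≡0 : c ℤ.* v u q ≡ + 0
    c*v≡0 = begin
      c ℤ.* v u q              ≡⟨ ℤ.+-identityʳ _ ⟨
      c ℤ.* v u q ℤ.+ + 0      ≡⟨ cong (λ y → c ℤ.* v u q ℤ.+ y) (Σ·-zero cs≡0 (Vec.map (λ x → v x q) us)) ⟨
      c ℤ.* v u q ℤ.+ S q      ≡⟨ zero-sum q ⟩
      + 0                      ∎
    c≡0 : c ≡ + 0
    c≡0 with ℤ.i*j≡0⇒i≡0∨j≡0 c c*v≡0
    ... | inj₁ eq = eq
    ... | inj₂ eq = contradiction eq vuq≢0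

  -- A weak form of "the columns `qs` span the columns `js`". Only equality of rows is propagated,
  -- not linear combinations, and this is all that the injectivity of the coding asks for.
  Separates : (X → ℕ → ℤ) → List X → List ℕ → List ℕ → Set
  Separates v U qs js = ∀ {x y} → x ∈ U → y ∈ U → All (λ q → v x q ≡ v y q) qs → All (λ j → v x j ≡ v y j) js

  -- For rows that agree in column `q`, the pivoted entries in column `j` agree exactly when the
  -- original ones do, because the nonzero factor `v u q` can be cancelled.
  Separates-pivot : ∀ v u q → v u q ≢ + 0 → ∀ {U qs js} →
    Separates (pivot v u q) U qs js → Separates v U (q ∷ qs) (q ∷ js)
  Separates-pivot v u q vuq≢0 sep {x} {y} x∈U y∈U (eq ∷ eqs) =
    eq ∷ All.map back (sep x∈U y∈U (All.map forth eqs))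
    where
    forth : ∀ {j} → v x j ≡ v y j → pivot v u q x j ≡ pivot v u q y j
    forth {j} e = cong₂ (λ a b → v u q ℤ.* a ℤ.- b ℤ.* v u j) e eq
    back : ∀ {j} → pivot v u q x j ≡ pivot v u q y j → v x j ≡ v y j
    back {j} e = ℤ.*-cancelˡ-≡ (v u q) _ _ {{ℤ.≢-nonZero vuq≢0}}
      (ℤ+.∙-cancelʳ (ℤ.- (v x q ℤ.* v u j)) _ _
        (trans e (cong (λ b → v u q ℤ.* v y j ℤ.- b ℤ.* v u j) (sym eq))))

  -- Fraction-free Gaussian elimination: columns are treated in the given order,
  -- so that the pivot columns form a sublist.
  eliminate : ∀ m v U js →
    (∃[ us ] Independent {suc m} v us) ⊎
    (∃[ qs ] (qs ⊆ js × length qs ≤ m × Separates v U qs js))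
  eliminate m v U [] = inj₂ ([] , [] , z≤n , λ _ _ _ → [])
  eliminate m v U (j ∷ js) with any? (λ u → ¬? (v u j ℤ.≟ + 0)) U
  eliminate m v U (j ∷ js) | no none with eliminate m v U js
  ... | inj₁ indep = inj₁ indep
  ... | inj₂ (qs , qs⊆js , len , sep) =
    inj₂ (qs , j ∷ʳ qs⊆js , len , λ x∈U y∈U eqs → trans (vanish x∈U) (sym (vanish y∈U)) ∷ sep x∈U y∈U eqs)
    where
    vanish : ∀ {x} → x ∈ U → v x j ≡ + 0
    vanish {x} x∈U = decidable-stable (v x j ℤ.≟ + 0) (All.lookup (All.¬Any⇒All¬ U none) x∈U)
  eliminate zero v U (j ∷ js) | yes some with satisfied some
  ... | u , vuj≢0 = inj₁ (u ∷ [] , Independent-pivot v u j vuj≢0 [] λ { [] _ → [] })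
  eliminate (suc m) v U (j ∷ js) | yes some with satisfied some
  -- `U` is kept whole: the pivoted row of `u` is zero and stays zero, so `u` is never chosen again.
  ... | u , vuj≢0 with eliminate m (pivot v u j) U js
  ...   | inj₁ (us , indep) = inj₁ (u ∷ us , Independent-pivot v u j vuj≢0 us indep)
  ...   | inj₂ (qs , qs⊆js , len , sep) =
    inj₂ (j ∷ qs , refl ∷ qs⊆js , s≤s len , Separates-pivot v u j vuj≢0 sep)

-- Valuations

count : ℕ → List ℕ → ℕ
count q xs = length (filter (q ℕ.≟_) xs)

count-++ : ∀ q xs ys → count q (xs ++ ys) ≡ count q xs + count q ys
count-++ q xs ys = trans (cong length (filter-++ (q ℕ.≟_) xs ys)) (length-++ (filter (q ℕ.≟_) xs))

count-↭ : ∀ q {xs ys} → xs ↭ ys → count q xs ≡ count q ys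
count-↭ q xs↭ys = ↭-length (filter-↭ (q ℕ.≟_) xs↭ys)

count-here : ∀ q xs → count q (q ∷ xs) ≡ suc (count q xs)
count-here q xs = cong length (filter-accept (q ℕ.≟_) refl)

count-there : ∀ {q x} → q ≢ x → ∀ xs → count q (x ∷ xs) ≡ count q xs
count-there q≢x xs = cong length (filter-reject (_ ℕ.≟_) q≢x)

count≢0⇒∈ : ∀ q xs → count q xs ≢ 0 → q ∈ xs
count≢0⇒∈ q []       c≢0 = contradiction refl c≢0
count≢0⇒∈ q (x ∷ xs) c≢0 with q ℕ.≟ x
... | yes refl = here refl
... | no  q≢x  = there (count≢0⇒∈ q xs (λ c≡0 → c≢0 (trans (count-there q≢x xs) c≡0)))

product-count : ∀ xs ys → (∀ q → count q xs ≡ count q ys) → product xs ≡ product ys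
product-count []       []       eq = refl
product-count []       (y ∷ ys) eq = contradiction (trans (eq y) (count-here y ys)) λ ()
product-count (x ∷ xs) ys       eq
  with ∈-∃++ (count≢0⇒∈ x ys (λ c≡0 → contradiction (trans (sym (count-here x xs)) (trans (eq x) c≡0)) λ ()))
... | ys₁ , ys₂ , refl = begin
  x * product xs           ≡⟨ cong (x *_) (product-count xs (ys₁ ++ ys₂) eq′) ⟩
  x * product (ys₁ ++ ys₂) ≡⟨ product-↭ (shift x ys₁ ys₂) ⟨
  product (ys₁ ++ x ∷ ys₂) ∎
  where
  open ≡-Reasoning
  eq′ : ∀ q → count q xs ≡ count q (ys₁ ++ ys₂)
  eq′ q with q ℕ.≟ x
  ... | yes refl = ℕ.suc-injective (begin
    suc (count q xs)           ≡⟨ count-here q xs ⟨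
    count q (q ∷ xs)           ≡⟨ eq q ⟩
    count q (ys₁ ++ q ∷ ys₂)   ≡⟨ count-↭ q (shift q ys₁ ys₂) ⟩
    count q (q ∷ ys₁ ++ ys₂)   ≡⟨ count-here q (ys₁ ++ ys₂) ⟩
    suc (count q (ys₁ ++ ys₂)) ∎)
  ... | no q≢x = begin
    count q xs               ≡⟨ count-there q≢x xs ⟨
    count q (x ∷ xs)         ≡⟨ eq q ⟩
    count q (ys₁ ++ x ∷ ys₂) ≡⟨ count-↭ q (shift x ys₁ ys₂) ⟩
    count q (x ∷ ys₁ ++ ys₂) ≡⟨ count-there q≢x (ys₁ ++ ys₂) ⟩
    count q (ys₁ ++ ys₂)     ∎

Π^ : List ℕ → (ℕ → ℕ) → ℕ
Π^ []       f = 1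
Π^ (q ∷ qs) f = q ^ f q * Π^ qs f

Π^-mono : ∀ qs → All NonZero qs → ∀ {f g} → (∀ q → f q ≤ g q) → Π^ qs f ≤ Π^ qs g
Π^-mono []       []           f≤g = ℕ.≤-refl
Π^-mono (q ∷ qs) (q≢0 ∷ qs≢0) f≤g = ℕ.*-mono-≤ (ℕ.^-monoʳ-≤ q {{q≢0}} (f≤g q)) (Π^-mono qs qs≢0 f≤g)

Π^-cong : ∀ qs {f g} → All (λ q → f q ≡ g q) qs → Π^ qs f ≡ Π^ qs g
Π^-cong []       []         = refl
Π^-cong (q ∷ qs) (eq ∷ eqs) = cong₂ (λ e P → q ^ e * P) eq (Π^-cong qs eqs)

-- As `qs` has no repetition, an entry `x` is counted by at most one `q`. Adding it multiplies the
-- left side by `x` or by 1, hence by at most `x`.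
Π^-count : ∀ qs → Unique qs → ∀ xs → All NonZero xs → Π^ qs (λ q → count q xs) ≤ product xs
Π^-count qs unique [] [] = ℕ.≤-reflexive (trivial qs)
  where
  trivial : ∀ qs → Π^ qs (λ _ → 0) ≡ 1
  trivial []       = refl
  trivial (q ∷ qs) = trans (ℕ.+-identityʳ _) (trivial qs)
Π^-count qs unique (x ∷ xs) (x≢0 ∷ xs≢0) = ℕ.≤-trans (step qs unique)
  (ℕ.*-monoʳ-≤ x (Π^-count qs unique xs xs≢0))
  where
  open ℕ.≤-Reasoning
  step : ∀ qs → Unique qs → Π^ qs (λ q → count q (x ∷ xs)) ≤ x * Π^ qs (λ q → count q xs)
  step []       []            = ℕ.≤-trans (>-nonZero⁻¹ x {{x≢0}}) (ℕ.≤-reflexive (sym (ℕ.*-identityʳ x)))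
  step (q ∷ qs) (q∉qs ∷ unique) with q ℕ.≟ x
  ... | yes refl = begin
    q ^ count q (q ∷ xs) * Π^ qs (λ r → count r (q ∷ xs))
      ≡⟨ cong (λ e → q ^ e * Π^ qs (λ r → count r (q ∷ xs))) (count-here q xs) ⟩
    q ^ suc (count q xs) * Π^ qs (λ r → count r (q ∷ xs))
      ≡⟨ cong (q ^ suc (count q xs) *_) (Π^-cong qs (All.map (λ q≢r → count-there (λ r≡q → q≢r (sym r≡q)) xs) q∉qs)) ⟩
    q ^ suc (count q xs) * Π^ qs (λ r → count r xs)
      ≡⟨ ℕ.*-assoc q (q ^ count q xs) _ ⟩
    q * (q ^ count q xs * Π^ qs (λ r → count r xs)) ∎
  ... | no q≢x = begin
    q ^ count q (x ∷ xs) * Π^ qs (λ r → count r (x ∷ xs))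
      ≡⟨ cong (λ e → q ^ e * Π^ qs (λ r → count r (x ∷ xs))) (count-there q≢x xs) ⟩
    q ^ count q xs * Π^ qs (λ r → count r (x ∷ xs))
      ≤⟨ ℕ.*-monoʳ-≤ (q ^ count q xs) (step qs unique) ⟩
    q ^ count q xs * (x * Π^ qs (λ r → count r xs))
      ≡⟨ ℕ.*-assoc (q ^ count q xs) x _ ⟨
    q ^ count q xs * x * Π^ qs (λ r → count r xs)
      ≡⟨ cong (_* Π^ qs (λ r → count r xs)) (ℕ.*-comm (q ^ count q xs) x) ⟩
    x * q ^ count q xs * Π^ qs (λ r → count r xs)
      ≡⟨ ℕ.*-assoc x (q ^ count q xs) _ ⟩
    x * (q ^ count q xs * Π^ qs (λ r → count r xs)) ∎

-- The exponent of q in n if q is prime; junk value 0 if n is zero or q is not prime.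
val : ℕ → ℕ → ℕ
val q zero      = 0
val q n@(suc _) = count q (factors (factorise n))

-- Uniqueness of factorisation lets a valuation be read off from any convenient factorisation, such
-- as the concatenation used in `val-*`.
val-factorisation : ∀ q {n} .{{_ : NonZero n}} (f : PrimeFactorisation n) → val q n ≡ count q (factors f)
val-factorisation q {n@(suc _)} f = count-↭ q (factorisationUnique (factorise n) f)

val-* : ∀ q m n .{{_ : NonZero m}} .{{_ : NonZero n}} → val q (m * n) ≡ val q m + val q n
val-* q m@(suc _) n@(suc _) = trans (val-factorisation q fmn) (count-++ q (factors fm) (factors fn))
  where
  fm = factorise m
  fn = factorise n
  fmn : PrimeFactorisation (m * n)
  fmn = record
    { factors = factors fm ++ factors fn
    ; isFactorisation = trans (cong₂ _*_ (isFactorisation fm) (isFactorisation fn))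
                              (sym (product-++ (factors fm) (factors fn)))
    ; factorsPrime = All.++⁺ (factorsPrime fm) (factorsPrime fn) }

val-^ : ∀ q m .{{_ : NonZero m}} e → val q (m ^ e) ≡ e * val q m
val-^ q m zero    = refl
val-^ q m (suc e) = trans (val-* q m (m ^ e)) (cong (_+_ (val q m)) (val-^ q m e))
  where instance _ = ℕ.m^n≢0 m e

val-injective : ∀ m n .{{_ : NonZero m}} .{{_ : NonZero n}} → (∀ q → val q m ≡ val q n) → m ≡ n
val-injective m@(suc _) n@(suc _) eq = begin
  m                               ≡⟨ isFactorisation (factorise m) ⟩
  product (factors (factorise m)) ≡⟨ product-count (factors (factorise m)) (factors (factorise n)) eq ⟩
  product (factors (factorise n)) ≡⟨ isFactorisation (factorise n) ⟨
  n                               ∎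
  where open ≡-Reasoning

val≢0⇒prime-divisor : ∀ q n → val q n ≢ 0 → Prime q × q ℕ.∣ n
val≢0⇒prime-divisor q zero      v≢0 = contradiction refl v≢0
val≢0⇒prime-divisor q n@(suc _) v≢0 = All.lookup (factorsPrime f) q∈f ,
  subst (q ℕ.∣_) (sym (isFactorisation f)) (∈⇒∣product q∈f)
  where
  f = factorise n
  q∈f : q ∈ factors f
  q∈f = count≢0⇒∈ q (factors f) v≢0

Π^-val : ∀ qs → Unique qs → ∀ n .{{_ : NonZero n}} → Π^ qs (λ q → val q n) ≤ n
Π^-val qs unique n@(suc _) = ℕ.≤-trans
  (Π^-count qs unique (factors f) (All.map prime⇒nonZero (factorsPrime f)))
  (ℕ.≤-reflexive (sym (isFactorisation f)))
  where f = factorise n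

-- The primes p_j and smooth numbers

-- The witness `x` rules out the default value `d`, and in an ascending list the first hit is the
-- smallest.
firstWith-least : ∀ f d {xs} → AllPairs _<_ xs → ∀ {x} → x ∈ xs → T (f x) →
  T (f (firstWith f d xs)) × firstWith f d xs ∈ xs × firstWith f d xs ≤ x
firstWith-least f d {y ∷ xs} (y< ∷ sorted) x∈ fx with f y in eq
firstWith-least f d {y ∷ xs} (y< ∷ sorted) (here refl)  fx | true  = fx , here refl , ℕ.≤-refl
firstWith-least f d {y ∷ xs} (y< ∷ sorted) (there x∈xs) fx | true  =
  subst T (sym eq) tt , here refl , ℕ.<⇒≤ (All.lookup y< x∈xs)
firstWith-least f d {y ∷ xs} (y< ∷ sorted) (here refl)  fx | false = ⊥-elim (subst T eq fx)
firstWith-least f d {y ∷ xs} (y< ∷ sorted) (there x∈xs) fx | false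
  with firstWith-least f d sorted x∈xs fx
... | fv , v∈xs , v≤x = fv , there v∈xs , v≤x

range-ascending : ∀ m n → AllPairs _<_ (range m n)
range-ascending m n = AllPairs.map⁺ (AllPairs.applyUpTo⁺₁ (λ i → i) n λ i<j _ → ℕ.+-monoʳ-< m i<j)

∈-range⁺ : ∀ {m n x} → m ≤ x → x < m + n → x ∈ range m n
∈-range⁺ {m} {n} {x} m≤x x<m+n = subst (_∈ range m n) (ℕ.m+[n∸m]≡n m≤x)
  (∈-map⁺ (_+_ m) (∈-upTo⁺ (ℕ.+-cancelˡ-< m _ _ (subst (_< m + n) (sym (ℕ.m+[n∸m]≡n m≤x)) x<m+n))))

∈-range⁻ : ∀ {m n x} → x ∈ range m n → m ≤ x × x < m + n
∈-range⁻ {m} {n} x∈ with ∈-map⁻ (_+_ m) x∈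
... | i , i∈ , refl = ℕ.m≤m+n m i , ℕ.+-monoʳ-< m (∈-upTo⁻ i∈)

prime-divisor : ∀ n → 1 < n → ∃[ q ] (Prime q × q ℕ.∣ n)
prime-divisor n@(suc _) 1<n with factorise n
... | record { factors = [] ; isFactorisation = refl } = contradiction 1<n (ℕ.<-irrefl refl)
... | record { factors = q ∷ qs ; isFactorisation = eq ; factorsPrime = q-prime ∷ _ } =
  q , q-prime , subst (q ℕ.∣_) (sym eq) (ℕ.m∣m*n (product qs))

n∣n! : ∀ n .{{_ : NonZero n}} → n ℕ.∣ n !
n∣n! (suc n) = ℕ.m∣m*n (n !)

-- A prime divisor of n! + 1 that is at most n would divide n! and therefore 1. The upper bound
-- places the prime in the window searched by `nextPrime`.
euclid : ∀ n → ∃[ q ] (Prime q × n < q × q ≤ suc (n !))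
euclid n with prime-divisor (suc (n !)) (s≤s (ℕ.1≤n! n))
... | q , q-prime , q∣ = q , q-prime , ℕ.≰⇒> q≰n , ℕ.∣⇒≤ q∣
  where
  q≰n : ¬ q ≤ n
  q≰n q≤n = ¬prime[1] (subst Prime (ℕ.∣1⇒≡1 (ℕ.∣m+n∣m⇒∣n (subst (q ℕ.∣_) (ℕ.+-comm 1 (n !)) q∣) q∣n!)) q-prime)
    where
    q∣n! : q ℕ.∣ n !
    q∣n! = ℕ.∣-trans (n∣n! q {{prime⇒nonZero q-prime}}) (ℕ.m≤n⇒m!∣n! q≤n)

module _ (n : ℕ) (1≤n : 1 ≤ n) where

  private
    nextPrime-below : ∀ {q} → Prime q → n < q → q < suc n + n ! →
      T ⌊ prime? (nextPrime n) ⌋ × nextPrime n ∈ range (suc n) (n !) × nextPrime n ≤ q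
    nextPrime-below q-prime n<q q< = firstWith-least (λ q → ⌊ prime? q ⌋) (n ! + 1)
      (range-ascending (suc n) (n !)) (∈-range⁺ n<q q<) (fromWitness q-prime)

    nextPrime-spec : T ⌊ prime? (nextPrime n) ⌋ × nextPrime n ∈ range (suc n) (n !)
    nextPrime-spec with euclid n
    -- The window consists of n + 1, ..., n + n!, and it reaches n! + 1 because n is at least 1.
    ... | q , q-prime , n<q , q≤ with nextPrime-below q-prime n<q (s≤s (ℕ.≤-trans q≤ (ℕ.+-monoˡ-≤ (n !) 1≤n)))
    ...   | prime , ∈range , _ = prime , ∈range

  nextPrime-prime : Prime (nextPrime n)
  nextPrime-prime = toWitness (proj₁ nextPrime-spec)

  nextPrime-> : n < nextPrime n
  nextPrime-> = proj₁ (∈-range⁻ (proj₂ nextPrime-spec))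

  nextPrime-≤ : ∀ {q} → Prime q → n < q → nextPrime n ≤ q
  nextPrime-≤ {q} q-prime n<q with q ℕ.<? suc n + n !
  ... | yes q< = proj₂ (proj₂ (nextPrime-below q-prime n<q q<))
  -- A prime beyond the window exceeds the one found inside it.
  ... | no  q≮ = ℕ.<⇒≤ (ℕ.<-≤-trans (proj₂ (∈-range⁻ (proj₂ nextPrime-spec))) (ℕ.≮⇒≥ q≮))

nthPrime≥1 : ∀ j → 1 ≤ nthPrime j
nthPrime≥1 zero    = ℕ.≤-refl
nthPrime≥1 (suc j) = ℕ.≤-trans (nthPrime≥1 j) (ℕ.<⇒≤ (nextPrime-> _ (nthPrime≥1 j)))

nthPrime-prime : ∀ j → Prime (nthPrime (suc j))
nthPrime-prime j = nextPrime-prime _ (nthPrime≥1 j)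

nthPrime-< : ∀ j → nthPrime j < nthPrime (suc j)
nthPrime-< j = nextPrime-> _ (nthPrime≥1 j)

nthPrime-≤ : ∀ j {q} → Prime q → nthPrime j < q → nthPrime (suc j) ≤ q
nthPrime-≤ j = nextPrime-≤ _ (nthPrime≥1 j)

Smooth : ℕ → ℕ → Set
Smooth y n = ∀ {q} → Prime q → q ℕ.∣ n → q ≤ y

T-clause⁺ : ∀ a b c → (T a → T b → T c) → T (not (a ∧ b) ∨ c)
T-clause⁺ true  true  c f = f tt tt
T-clause⁺ true  false c f = tt
T-clause⁺ false b     c f = tt

T-clause⁻ : ∀ a b c → T (not (a ∧ b) ∨ c) → T a → T b → T c
T-clause⁻ true true c t _ _ = t

smooth⁺ : ∀ {y n} → Smooth y n → T (smooth y n)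
smooth⁺ {y} {n} sm = All.all⁻ _ (All.universal
  (λ q → T-clause⁺ ⌊ prime? q ⌋ ⌊ q ℕ.∣? n ⌋ ⌊ q ℕ.≤? y ⌋
    λ pr d → fromWitness (sm (toWitness pr) (toWitness d))) (upTo (suc n)))

smooth⁻ : ∀ {y n} .{{_ : NonZero n}} → T (smooth y n) → Smooth y n
smooth⁻ {y} {n} t {q} pr d = toWitness (T-clause⁻ ⌊ prime? q ⌋ ⌊ q ℕ.∣? n ⌋ ⌊ q ℕ.≤? y ⌋
  (All.lookup (All.all⁺ (λ q → not (⌊ prime? q ⌋ ∧ ⌊ q ℕ.∣? n ⌋) ∨ ⌊ q ℕ.≤? y ⌋) (upTo (suc n)) t) (∈-upTo⁺ (s≤s (ℕ.∣⇒≤ d)))) (fromWitness pr) (fromWitness d))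

smooths : ℕ → ℕ → List ℕ
smooths x y = filter (λ n → T? (smooth y n)) (range 1 x)

∈-smooths : ∀ {x y n} .{{_ : NonZero n}} → n ≤ x → Smooth y n → n ∈ smooths x y
∈-smooths {n = n} n≤x sm = ∈-filter⁺ _ (∈-range⁺ (>-nonZero⁻¹ n) (s≤s n≤x)) (smooth⁺ sm)

Ψ-mono : ∀ x {y y′} → y ≤ y′ → Ψ x y ≤ Ψ x y′
Ψ-mono x {y} {y′} y≤y′ = pigeonhole _≡_ (λ { refl refl → refl })
  (Unique.filter⁺ _ (Unique.map⁺ (ℕ.+-cancelˡ-≡ 1 _ _) (Unique.upTo⁺ x))) (smooths x y′)
  λ {n} n∈ → n , weaken n∈ , refl
  where
  weaken : ∀ {n} → n ∈ smooths x y → n ∈ smooths x y′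
  weaken n∈ with ∈-filter⁻ (λ n → T? (smooth y n)) {xs = range 1 x} n∈
  ... | n∈range , sm = ∈-filter⁺ _ n∈range (smooth⁺ λ pr d →
    ℕ.≤-trans (smooth⁻ {{>-nonZero (proj₁ (∈-range⁻ n∈range))}} sm pr d) y≤y′)

-- Binomial sums over words

Σ< : ℕ → (ℕ → ℕ) → ℕ
Σ< zero    f = 0
Σ< (suc n) f = f 0 + Σ< n (f ∘ suc)

sum-upTo : ∀ n f → sum (map f (upTo n)) ≡ Σ< n f
sum-upTo zero    f = refl
sum-upTo (suc n) f = cong (_+_ (f 0)) (trans
  (cong sum (trans (map-applyUpTo suc f n) (sym (map-applyUpTo (λ i → i) (f ∘ suc) n)))) (sum-upTo n (f ∘ suc)))

Σ<-cong : ∀ n {f g} → (∀ i → i < n → f i ≡ g i) → Σ< n f ≡ Σ< n g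
Σ<-cong zero    eq = refl
Σ<-cong (suc n) eq = cong₂ _+_ (eq 0 (s≤s z≤n)) (Σ<-cong n λ i i<n → eq (suc i) (s≤s i<n))

Σ<-+ : ∀ n f g → Σ< n (λ i → f i + g i) ≡ Σ< n f + Σ< n g
Σ<-+ zero    f g = refl
Σ<-+ (suc n) f g = trans (cong (λ S → f 0 + g 0 + S) (Σ<-+ n (f ∘ suc) (g ∘ suc)))
  (interchange (f 0) (g 0) (Σ< n (f ∘ suc)) (Σ< n (g ∘ suc)))

Σ<-last : ∀ n f → Σ< (suc n) f ≡ Σ< n f + f n
Σ<-last zero    f = ℕ.+-comm (f 0) 0
Σ<-last (suc n) f = trans (cong (_+_ (f 0)) (Σ<-last n (f ∘ suc))) (sym (ℕ.+-assoc (f 0) _ _))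

-- The sum of f (i + #true) (j + #false) over all words in {true, false} of length m.
wordSum : (ℕ → ℕ → ℕ) → ℕ → ℕ → ℕ → ℕ
wordSum f i j zero    = f i j
wordSum f i j (suc m) = wordSum f (suc i) j m + wordSum f i (suc j) m

-- There are C(m,l) words with l letters `true`. The first letter shifts one of the two indices, and
-- the two resulting sums merge by Pascal's rule.
wordSum-binomial : ∀ f i j m → wordSum f i j m ≡ Σ< (suc m) (λ l → (m C l) * f (l + i) (m ∸ l + j))
wordSum-binomial f i j zero    = sym (trans (ℕ.+-identityʳ _) (ℕ.+-identityʳ _))
wordSum-binomial f i j (suc m) = begin
  wordSum f (suc i) j m + wordSum f i (suc j) m
    ≡⟨ cong₂ _+_ (wordSum-binomial f (suc i) j m) (wordSum-binomial f i (suc j) m) ⟩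
  Σ< (suc m) (λ l → (m C l) * f (l + suc i) (m ∸ l + j)) + Σ< (suc m) (λ l → (m C l) * f (l + i) (m ∸ l + suc j))
    ≡⟨ cong₂ _+_ (Σ<-cong (suc m) λ l _ → cong (λ a → (m C l) * f a (m ∸ l + j)) (ℕ.+-suc l i)) shifted ⟩
  Σ< (suc m) g + (h 0 + Σ< (suc m) (h ∘ suc))
    ≡⟨ ℕ.+-comm (Σ< (suc m) g) _ ⟩
  h 0 + Σ< (suc m) (h ∘ suc) + Σ< (suc m) g
    ≡⟨ ℕ.+-assoc (h 0) _ _ ⟩
  h 0 + (Σ< (suc m) (h ∘ suc) + Σ< (suc m) g)
    ≡⟨ cong (_+_ (h 0)) (ℕ.+-comm (Σ< (suc m) (h ∘ suc)) _) ⟩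
  h 0 + (Σ< (suc m) g + Σ< (suc m) (h ∘ suc))
    ≡⟨ cong (_+_ (h 0)) (Σ<-+ (suc m) g (h ∘ suc)) ⟨
  h 0 + Σ< (suc m) (λ l → g l + h (suc l))
    ≡⟨ cong (_+_ (h 0)) (Σ<-cong (suc m) λ l _ → pascal l) ⟩
  Σ< (suc (suc m)) (λ l → (suc m C l) * f (l + i) (suc m ∸ l + j)) ∎
  where
  open ≡-Reasoning
  g h : ℕ → ℕ
  g l = (m C l) * f (suc (l + i)) (m ∸ l + j)
  h l = (m C l) * f (l + i) (suc m ∸ l + j)
  pascal : ∀ l → g l + h (suc l) ≡ (suc m C suc l) * f (suc l + i) (m ∸ l + j)
  pascal l = trans (sym (ℕ.*-distribʳ-+ (f (suc l + i) (m ∸ l + j)) (m C l) (m C suc l)))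
    (cong (_* f (suc l + i) (m ∸ l + j)) (nCk+nC[k+1]≡[n+1]C[k+1] m l))
  -- Appending the vanishing term with C(m,m+1) makes the sum one longer, so that its leading term
  -- can be split off and the rest lines up with `g`.
  shifted : Σ< (suc m) (λ l → (m C l) * f (l + i) (m ∸ l + suc j)) ≡ Σ< (suc (suc m)) h
  shifted = begin
    Σ< (suc m) (λ l → (m C l) * f (l + i) (m ∸ l + suc j))
      ≡⟨ Σ<-cong (suc m) (λ l l<1+m → cong (λ b → (m C l) * f (l + i) b)
           (trans (ℕ.+-suc (m ∸ l) j) (cong (_+ j) (sym (ℕ.+-∸-assoc 1 (ℕ.≤-pred l<1+m)))))) ⟩
    Σ< (suc m) h
      ≡⟨ ℕ.+-identityʳ _ ⟨
    Σ< (suc m) h + 0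
      ≡⟨ cong (λ c → Σ< (suc m) h + c * f (suc m + i) (m ∸ m + j)) (k>n⇒nCk≡0 (ℕ.n<1+n m)) ⟨
    Σ< (suc m) h + h (suc m)
      ≡⟨ Σ<-last (suc m) h ⟨
    Σ< (suc (suc m)) h ∎

module _ {f : ℕ → ℕ → ℕ} (f-mono : ∀ {i i′ j j′} → i ≤ i′ → j ≤ j′ → f i j ≤ f i′ j′) where

  wordSum-mono : ∀ m {i i′ j j′} → i ≤ i′ → j ≤ j′ → wordSum f i j m ≤ wordSum f i′ j′ m
  wordSum-mono zero    i≤ j≤ = f-mono i≤ j≤
  wordSum-mono (suc m) i≤ j≤ = ℕ.+-mono-≤ (wordSum-mono m (s≤s i≤) j≤) (wordSum-mono m i≤ (s≤s j≤))

  -- The rank may fall short of s + 1, so short words have to be bounded by long ones. An additional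
  -- letter only raises an index of the monotone `f`.
  wordSum-length-mono : ∀ {m n} i j → m ≤ n → wordSum f i j m ≤ wordSum f i j n
  wordSum-length-mono {n = n} i j z≤n = start n i j
    where
    start : ∀ n i j → f i j ≤ wordSum f i j n
    start zero    i j = ℕ.≤-refl
    start (suc n) i j = ℕ.≤-trans (f-mono (ℕ.n≤1+n i) ℕ.≤-refl) (ℕ.≤-trans (start n (suc i) j) (ℕ.m≤m+n _ _))
  wordSum-length-mono i j (s≤s m≤n) =
    ℕ.+-mono-≤ (wordSum-length-mono (suc i) j m≤n) (wordSum-length-mono i (suc j) m≤n)

nthPrime-mono : ∀ {i j} → i ≤ j → nthPrime i ≤ nthPrime j
nthPrime-mono {i} {j} i≤j with ℕ.m≤n⇒m<n∨m≡n i≤j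
... | inj₂ refl = ℕ.≤-refl
nthPrime-mono {i} {suc j} i≤j | inj₁ (s≤s i≤j′) = ℕ.≤-trans (nthPrime-mono i≤j′) (ℕ.<⇒≤ (nthPrime-< j))

ΨΨ : ℕ → ℕ → ℕ → ℕ
ΨΨ k i j = Ψ k (nthPrime i) * Ψ k (nthPrime j)

wordSum≡Φ̃ : ∀ k m → wordSum (ΨΨ k) 0 0 m ≡ Φ̃ k m
wordSum≡Φ̃ k m = begin
  wordSum (ΨΨ k) 0 0 m
    ≡⟨ wordSum-binomial (ΨΨ k) 0 0 m ⟩
  Σ< (suc m) (λ l → (m C l) * ΨΨ k (l + 0) (m ∸ l + 0))
    ≡⟨ Σ<-cong (suc m) (λ l _ → trans
         (cong₂ (λ a b → (m C l) * ΨΨ k a b) (ℕ.+-identityʳ l) (ℕ.+-identityʳ (m ∸ l)))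
         (sym (ℕ.*-assoc (m C l) (Ψ k (nthPrime l)) (Ψ k (nthPrime (m ∸ l)))))) ⟩
  Σ< (suc m) (λ l → (m C l) * Ψ k (nthPrime l) * Ψ k (nthPrime (m ∸ l)))
    ≡⟨ sum-upTo (suc m) _ ⟨
  Φ̃ k m ∎
  where open ≡-Reasoning

wordSum≤Φ̃ : ∀ k {m n} → m ≤ n → wordSum (ΨΨ k) 0 0 m ≤ Φ̃ k n
wordSum≤Φ̃ k {m} {n} m≤n = ℕ.≤-trans
  (wordSum-length-mono (λ i≤ j≤ → ℕ.*-mono-≤ (Ψ-mono k (nthPrime-mono i≤)) (Ψ-mono k (nthPrime-mono j≤))) 0 0 m≤n)
  (ℕ.≤-reflexive (wordSum≡Φ̃ k n))

-- Encoding exponent vectors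

-- The signs of the exponents, followed by the numerator and the denominator after the replacement
-- of primes.
Code : Set
Code = List Bool × ℕ × ℕ

push : Bool → Code → Code
push b (w , xy) = b ∷ w , xy

-- The recursion follows `wordSum`: from `i = j = 0`, a word with i letters `true` and j letters
-- `false` is paired with a p_i-smooth and a p_j-smooth number.
codes : ℕ → ℕ → ℕ → ℕ → List Code
codes k i j zero    = map ([] ,_) (cartesianProduct (smooths k (nthPrime i)) (smooths k (nthPrime j)))
codes k i j (suc m) = map (push true) (codes k (suc i) j m) ++ map (push false) (codes k i (suc j) m)

length-cartesianProduct : {A B : Set} (xs : List A) (ys : List B) →
  length (cartesianProduct xs ys) ≡ length xs * length ys
length-cartesianProduct []       ys = refl
length-cartesianProduct (x ∷ xs) ys = trans (length-++ (map (x ,_) ys))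
  (cong₂ _+_ (length-map (x ,_) ys) (length-cartesianProduct xs ys))

length-codes : ∀ k i j m → length (codes k i j m) ≡ wordSum (ΨΨ k) i j m
length-codes k i j zero = trans (length-map _ (cartesianProduct xs ys)) (length-cartesianProduct xs ys)
  where
  xs = smooths k (nthPrime i)
  ys = smooths k (nthPrime j)
length-codes k i j (suc m) = trans (length-++ (map (push true) (codes k (suc i) j m)))
  (cong₂ _+_ (trans (length-map _ (codes k (suc i) j m)) (length-codes k (suc i) j m))
             (trans (length-map _ (codes k i (suc j) m)) (length-codes k i (suc j) m)))

-- The indices `i` and `j` count the primes already spent on each side, and `x`, `y` accumulate the
-- two products. An exponent zero counts as nonnegative and still spends a prime, so every position
-- of the word has a prime of its own.
encode : List ℤ → ℕ → ℕ → ℕ → ℕ → Code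
encode []             i j x y = [] , x , y
encode (+ a      ∷ es) i j x y = push true  (encode es (suc i) j (x * nthPrime (suc i) ^ a) y)
encode (-[1+ a ] ∷ es) i j x y = push false (encode es i (suc j) x (y * nthPrime (suc j) ^ suc a))

_⁺ : ℤ → ℕ
(+ a)    ⁺ = a
-[1+ _ ] ⁺ = 0

_⁻ : ℤ → ℕ
(+ _)    ⁻ = 0
-[1+ a ] ⁻ = suc a

Smooth-*-^ : ∀ i {x} a → Smooth (nthPrime i) x → Smooth (nthPrime (suc i)) (x * nthPrime (suc i) ^ a)
Smooth-*-^ i {x} a sm {q} pr d with euclidsLemma x (nthPrime (suc i) ^ a) pr d
... | inj₁ q∣x = ℕ.≤-trans (sm pr q∣x) (ℕ.<⇒≤ (nthPrime-< i))
... | inj₂ q∣p^a = divides-^ a q∣p^a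
  where
  divides-^ : ∀ a → q ℕ.∣ nthPrime (suc i) ^ a → q ≤ nthPrime (suc i)
  divides-^ zero    q∣1 = contradiction (subst Prime (ℕ.∣1⇒≡1 q∣1) pr) ¬prime[1]
  divides-^ (suc a) q∣  with euclidsLemma (nthPrime (suc i)) _ pr q∣
  ... | inj₁ q∣p = ℕ.∣⇒≤ {{>-nonZero (nthPrime≥1 (suc i))}} q∣p
  ... | inj₂ q∣′ = divides-^ a q∣′

*-^-nonZero : ∀ i x .{{_ : NonZero x}} a → NonZero (x * nthPrime i ^ a)
*-^-nonZero i x a = ℕ.m*n≢0 x (nthPrime i ^ a)
  where
  instance
    _ = >-nonZero (nthPrime≥1 i)
    _ = ℕ.m^n≢0 (nthPrime i) a

-- Replacing the primes qs by the smaller primes of the enumeration only decreases the two products.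
encode-∈ : ∀ k (e : ℕ → ℤ) {qs} → All Prime qs → AllPairs _<_ qs →
  ∀ i j x y .{{_ : NonZero x}} .{{_ : NonZero y}} →
  All (nthPrime i <_) qs → All (nthPrime j <_) qs → Smooth (nthPrime i) x → Smooth (nthPrime j) y →
  x * Π^ qs (λ q → e q ⁺) ≤ k → y * Π^ qs (λ q → e q ⁻) ≤ k →
  encode (map e qs) i j x y ∈ codes k i j (length qs)
encode-∈ k e [] [] i j x y i< j< smx smy x≤k y≤k = ∈-map⁺ ([] ,_)
  (∈-cartesianProduct⁺ (∈-smooths (subst (_≤ k) (ℕ.*-identityʳ x) x≤k) smx)
                       (∈-smooths (subst (_≤ k) (ℕ.*-identityʳ y) y≤k) smy))
encode-∈ k e {q ∷ qs} (pr ∷ prs) (q< ∷ sorted) i j x y (i<q ∷ i<) (j<q ∷ j<) smx smy x≤k y≤k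
  with e q
... | + a = let instance _ = *-^-nonZero (suc i) x a in
  ∈-++⁺ˡ (∈-map⁺ (push true) (encode-∈ k e prs sorted (suc i) j (x * nthPrime (suc i) ^ a) y
  -- The least prime above p_i is at most `q`, and the later entries of `qs` exceed `q`; so they
  -- exceed p_(i+1), and the induction can go on.
  (All.map (ℕ.≤-<-trans (nthPrime-≤ i pr i<q)) q<) j< (Smooth-*-^ i a smx) smy
  (ℕ.≤-trans (ℕ.≤-trans (ℕ.*-monoˡ-≤ (Π^ qs _) (ℕ.*-monoʳ-≤ x (ℕ.^-monoˡ-≤ a (nthPrime-≤ i pr i<q))))
    (ℕ.≤-reflexive (ℕ.*-assoc x (q ^ a) _))) x≤k)
  (subst (λ z → y * z ≤ k) (ℕ.*-identityˡ _) y≤k)))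
... | -[1+ a ] = let instance _ = *-^-nonZero (suc j) y (suc a) in
  ∈-++⁺ʳ _ (∈-map⁺ (push false) (encode-∈ k e prs sorted i (suc j) x (y * nthPrime (suc j) ^ suc a)
  i< (All.map (ℕ.≤-<-trans (nthPrime-≤ j pr j<q)) q<) smx (Smooth-*-^ j (suc a) smy)
  (subst (λ z → x * z ≤ k) (ℕ.*-identityˡ _) x≤k)
  (ℕ.≤-trans (ℕ.≤-trans (ℕ.*-monoˡ-≤ (Π^ qs _) (ℕ.*-monoʳ-≤ y (ℕ.^-monoˡ-≤ (suc a) (nthPrime-≤ j pr j<q))))
    (ℕ.≤-reflexive (ℕ.*-assoc y (q ^ suc a) _))) y≤k)))

*-^-injective : ∀ p .{{_ : NonZero p}} {x x′} → ¬ p ℕ.∣ x → ¬ p ℕ.∣ x′ → ∀ a b →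
  x * p ^ a ≡ x′ * p ^ b → a ≡ b × x ≡ x′
*-^-injective p {x} {x′} p∤x p∤x′ = go
  where
  move : ∀ z a → z * p ^ suc a ≡ p * (z * p ^ a)
  move z a = trans (sym (ℕ.*-assoc z p _)) (trans (cong (_* p ^ a) (ℕ.*-comm z p)) (ℕ.*-assoc p z _))
  go : ∀ a b → x * p ^ a ≡ x′ * p ^ b → a ≡ b × x ≡ x′
  go zero    zero    eq = refl , trans (sym (ℕ.*-identityʳ x)) (trans eq (ℕ.*-identityʳ x′))
  go zero    (suc b) eq = contradiction
    (subst (p ℕ.∣_) (trans (sym (move x′ b)) (trans (sym eq) (ℕ.*-identityʳ x))) (ℕ.m∣m*n _)) p∤x
  go (suc a) zero    eq = contradiction
    (subst (p ℕ.∣_) (trans (sym (move x a)) (trans eq (ℕ.*-identityʳ x′))) (ℕ.m∣m*n _)) p∤x′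
  go (suc a) (suc b) eq with go a b (ℕ.*-cancelˡ-≡ _ _ p (trans (sym (move x a)) (trans eq (move x′ b))))
  ... | a≡b , x≡x′ = cong suc a≡b , x≡x′

push-injective : ∀ {b b′ c c′} → push b c ≡ push b′ c′ → b ≡ b′ × c ≡ c′
push-injective refl = refl , refl

-- Decoding runs from the last prime back to the first. Equality of the later accumulators is known
-- by induction; since p_(i+1) does not divide a p_i-smooth number, its multiplicity reveals the
-- exponent, and what remains is the earlier accumulator. The accumulators may differ a priori,
-- hence the primed variables.
encode-injective : ∀ es es′ i j {x y x′ y′} →
  Smooth (nthPrime i) x → Smooth (nthPrime j) y → Smooth (nthPrime i) x′ → Smooth (nthPrime j) y′ →
  encode es i j x y ≡ encode es′ i j x′ y′ → es ≡ es′ × x ≡ x′ × y ≡ y′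
encode-injective [] [] i j sx sy sx′ sy′ refl = refl , refl , refl
encode-injective [] (+ _ ∷ _) i j sx sy sx′ sy′ ()
encode-injective [] (-[1+ _ ] ∷ _) i j sx sy sx′ sy′ ()
encode-injective (+ _ ∷ _) [] i j sx sy sx′ sy′ ()
encode-injective (-[1+ _ ] ∷ _) [] i j sx sy sx′ sy′ ()
encode-injective (+ _ ∷ _) (-[1+ _ ] ∷ _) i j sx sy sx′ sy′ eq = contradiction (proj₁ (push-injective eq)) λ ()
encode-injective (-[1+ _ ] ∷ _) (+ _ ∷ _) i j sx sy sx′ sy′ eq = contradiction (proj₁ (push-injective eq)) λ ()
encode-injective (+ a ∷ es) (+ b ∷ es′) i j sx sy sx′ sy′ eq
  with encode-injective es es′ (suc i) j (Smooth-*-^ i a sx) sy (Smooth-*-^ i b sx′) sy′ (proj₂ (push-injective eq))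
... | refl , eqx , eqy with *-^-injective (nthPrime (suc i)) {{>-nonZero (nthPrime≥1 (suc i))}} (coprime sx) (coprime sx′) a b eqx
  where
  coprime : ∀ {z} → Smooth (nthPrime i) z → ¬ nthPrime (suc i) ℕ.∣ z
  coprime sm d = ℕ.<⇒≱ (nthPrime-< i) (sm (nthPrime-prime i) d)
... | refl , eqx′ = refl , eqx′ , eqy
encode-injective (-[1+ a ] ∷ es) (-[1+ b ] ∷ es′) i j sx sy sx′ sy′ eq
  with encode-injective es es′ i (suc j) sx (Smooth-*-^ j (suc a) sy) sx′ (Smooth-*-^ j (suc b) sy′) (proj₂ (push-injective eq))
... | refl , eqx , eqy with *-^-injective (nthPrime (suc j)) {{>-nonZero (nthPrime≥1 (suc j))}} (coprime sy) (coprime sy′) (suc a) (suc b) eqy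
  where
  coprime : ∀ {z} → Smooth (nthPrime j) z → ¬ nthPrime (suc j) ℕ.∣ z
  coprime sm d = ℕ.<⇒≱ (nthPrime-< j) (sm (nthPrime-prime j) d)
... | refl , eqy′ = refl , eqx , eqy′

-- Auxiliary facts on lists, powers and signed differences

AllPairs-resp-⊆ : {A : Set} {R : A → A → Set} {xs ys : List A} → xs ⊆ ys → AllPairs R ys → AllPairs R xs
AllPairs-resp-⊆ []             []         = []
AllPairs-resp-⊆ (y ∷ʳ xs⊆ys)   (_ ∷ rys)  = AllPairs-resp-⊆ xs⊆ys rys
AllPairs-resp-⊆ (refl ∷ xs⊆ys) (ry ∷ rys) = All-resp-⊆ xs⊆ys ry ∷ AllPairs-resp-⊆ xs⊆ys rys

-- Gathers the chosen witnesses in one finite list, which provides the rows of the matrix to be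
-- eliminated.
preimages : {A B : Set} {f : B → A} {xs : List A} → All (λ x → ∃[ u ] (f u ≡ x)) xs →
  ∃[ U ] (∀ {x} → x ∈ xs → ∃[ u ] (u ∈ U × f u ≡ x))
preimages []              = [] , λ ()
preimages {f = f} {x ∷ xs} ((u , eq) ∷ all) with preimages all
... | U , lift = u ∷ U , λ
  { (here refl) → u , here refl , eq
  ; (there x∈)  → let (w , w∈U , eq′) = lift x∈ in w , there w∈U , eq′ }

^-distrib-* : ∀ x y n → (x ℤ.* y) ℤ.^ n ≡ x ℤ.^ n ℤ.* y ℤ.^ n
^-distrib-* x y zero    = refl
^-distrib-* x y (suc n) = trans (cong (x ℤ.* y ℤ.*_) (^-distrib-* x y n)) (eq x y (x ℤ.^ n) (y ℤ.^ n))
  where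
  eq : ∀ x y u v → x ℤ.* y ℤ.* (u ℤ.* v) ≡ x ℤ.* u ℤ.* (y ℤ.* v)
  eq = solve-∀

^-swap : ∀ x m n → (x ℤ.^ m) ℤ.^ n ≡ (x ℤ.^ n) ℤ.^ m
^-swap x m n = trans (ℤ.^-*-assoc x m n) (trans (cong (x ℤ.^_) (ℕ.*-comm m n)) (sym (ℤ.^-*-assoc x n m)))

pos-^ : ∀ m n → + (m ^ n) ≡ (+ m) ℤ.^ n
pos-^ m zero    = refl
pos-^ m (suc n) = trans (ℤ.pos-* m (m ^ n)) (cong ((+ m) ℤ.*_) (pos-^ m n))

abs-^ : ∀ x n → ∣ x ℤ.^ n ∣ ≡ ∣ x ∣ ^ n
abs-^ x zero    = refl
abs-^ x (suc n) = trans (ℤ.abs-* x (x ℤ.^ n)) (cong (∣ x ∣ *_) (abs-^ x n))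

abs-≡ : ∀ x y → ∣ x ∣ ≡ ∣ y ∣ → x ≡ y ⊎ x ≡ ℤ.- y
abs-≡ (+ m)       (+ n)       eq   = inj₁ (cong +_ eq)
abs-≡ (+ .(suc n)) -[1+ n ]    refl = inj₂ refl
abs-≡ -[1+ m ]    (+ .(suc m)) refl = inj₂ refl
abs-≡ -[1+ m ]    -[1+ .m ]   refl = inj₁ refl

⊖⁺≤ : ∀ m n → (m ℤ.⊖ n) ⁺ ≤ m
⊖⁺≤ m       zero    = ℕ.≤-refl
⊖⁺≤ zero    (suc n) = z≤n
⊖⁺≤ (suc m) (suc n) = subst (λ z → z ⁺ ≤ suc m) (sym (ℤ.[1+m]⊖[1+n]≡m⊖n m n)) (ℕ.≤-trans (⊖⁺≤ m n) (ℕ.n≤1+n m))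

⊖⁻≤ : ∀ m n → (m ℤ.⊖ n) ⁻ ≤ n
⊖⁻≤ m       zero    = z≤n
⊖⁻≤ zero    (suc n) = ℕ.≤-refl
⊖⁻≤ (suc m) (suc n) = subst (λ z → z ⁻ ≤ suc n) (sym (ℤ.[1+m]⊖[1+n]≡m⊖n m n)) (ℕ.≤-trans (⊖⁻≤ m n) (ℕ.n≤1+n n))

⊖≡⊖ : ∀ m n m′ n′ → m ℤ.⊖ n ≡ m′ ℤ.⊖ n′ → m + n′ ≡ m′ + n
⊖≡⊖ m n m′ n′ eq = ℤ.+-injective (begin
  + (m + n′)                          ≡⟨ swap (+ m) (+ n) (+ n′) ⟩
  (+ m ℤ.- + n) ℤ.+ (+ n ℤ.+ + n′)    ≡⟨ cong (ℤ._+ (+ n ℤ.+ + n′)) (ℤ.m-n≡m⊖n m n) ⟩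
  (m ℤ.⊖ n) ℤ.+ (+ n ℤ.+ + n′)        ≡⟨ cong (ℤ._+ (+ n ℤ.+ + n′)) eq ⟩
  (m′ ℤ.⊖ n′) ℤ.+ (+ n ℤ.+ + n′)      ≡⟨ cong (ℤ._+ (+ n ℤ.+ + n′)) (ℤ.m-n≡m⊖n m′ n′) ⟨
  (+ m′ ℤ.- + n′) ℤ.+ (+ n ℤ.+ + n′)  ≡⟨ swap′ (+ m′) (+ n) (+ n′) ⟩
  + (m′ + n)                          ∎)
  where
  open ≡-Reasoning
  swap : ∀ x y z → x ℤ.+ z ≡ (x ℤ.- y) ℤ.+ (y ℤ.+ z)
  swap = solve-∀
  swap′ : ∀ x y z → (x ℤ.- z) ℤ.+ (y ℤ.+ z) ≡ x ℤ.+ y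
  swap′ = solve-∀

-- Monomials

module _ {X : Set} where

  monomial : (X → ℤ) → ∀ {n} → Vec X n → Vec ℕ n → ℤ
  monomial f []       []       = + 1
  monomial f (u ∷ us) (e ∷ es) = f u ℤ.^ e ℤ.* monomial f us es

  monomial-* : ∀ f g {n} (us : Vec X n) es →
    monomial (λ u → f u ℤ.* g u) us es ≡ monomial f us es ℤ.* monomial g us es
  monomial-* f g []       []       = refl
  monomial-* f g (u ∷ us) (e ∷ es) =
    trans (cong₂ ℤ._*_ (^-distrib-* (f u) (g u) e) (monomial-* f g us es))
          (eq (f u ℤ.^ e) (g u ℤ.^ e) (monomial f us es) (monomial g us es))
    where
    eq : ∀ x y u v → x ℤ.* y ℤ.* (u ℤ.* v) ≡ x ℤ.* u ℤ.* (y ℤ.* v)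
    eq = solve-∀

  monomial-^ : ∀ f m {n} (us : Vec X n) es → monomial f us es ℤ.^ m ≡ monomial (λ u → f u ℤ.^ m) us es
  monomial-^ f m []       []       = ℤ.^-zeroˡ m
  monomial-^ f m (u ∷ us) (e ∷ es) =
    trans (^-distrib-* (f u ℤ.^ e) _ m) (cong₂ ℤ._*_ (^-swap (f u) e m) (monomial-^ f m us es))

  monomial-const : ∀ c {n} (us : Vec X n) es → monomial (λ _ → c) us es ≡ c ℤ.^ Vec.sum es
  monomial-const c []       []       = refl
  monomial-const c (u ∷ us) (e ∷ es) =
    trans (cong (c ℤ.^ e ℤ.*_) (monomial-const c us es)) (sym (ℤ.^-distribˡ-+-* c e (Vec.sum es)))

  monomial-≤ : ∀ f {k} → (∀ u → ∣ f u ∣ ≤ k) → ∀ {n} (us : Vec X n) es → ∣ monomial f us es ∣ ≤ k ^ Vec.sum es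
  monomial-≤ f         f≤k []       []       = ℕ.≤-refl
  monomial-≤ f {k = k} f≤k (u ∷ us) (e ∷ es) = begin
    ∣ f u ℤ.^ e ℤ.* monomial f us es ∣      ≡⟨ ℤ.abs-* (f u ℤ.^ e) _ ⟩
    ∣ f u ℤ.^ e ∣ * ∣ monomial f us es ∣    ≡⟨ cong (_* ∣ monomial f us es ∣) (abs-^ (f u) e) ⟩
    ∣ f u ∣ ^ e * ∣ monomial f us es ∣      ≤⟨ ℕ.*-mono-≤ (ℕ.^-monoˡ-≤ e (f≤k u)) (monomial-≤ f f≤k us es) ⟩
    k ^ e * k ^ Vec.sum es                  ≡⟨ ℕ.^-distribˡ-+-* k e (Vec.sum es) ⟨
    k ^ (e + Vec.sum es)                    ∎
    where open ℕ.≤-Reasoning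

  module _ (f : X → ℤ) (f≢0 : ∀ u → NonZero ∣ f u ∣) where

    monomial-nonZero : ∀ {n} (us : Vec X n) es → NonZero ∣ monomial f us es ∣
    monomial-nonZero []       []       = _
    monomial-nonZero (u ∷ us) (e ∷ es) =
      subst NonZero (sym (trans (ℤ.abs-* (f u ℤ.^ e) _) (cong (_* ∣ monomial f us es ∣) (abs-^ (f u) e))))
        (ℕ.m*n≢0 (∣ f u ∣ ^ e) _ {{ℕ.m^n≢0 ∣ f u ∣ e {{f≢0 u}}}} {{monomial-nonZero us es}})

    val-monomial : ∀ q {n} (us : Vec X n) es →
      + val q ∣ monomial f us es ∣ ≡ Σ· (Vec.map +_ es) (Vec.map (λ u → + val q ∣ f u ∣) us)
    val-monomial q []       []       = refl
    val-monomial q (u ∷ us) (e ∷ es) = begin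
      + val q ∣ f u ℤ.^ e ℤ.* M ∣            ≡⟨ cong (λ z → + val q z) (trans (ℤ.abs-* (f u ℤ.^ e) M) (cong (_* ∣ M ∣) (abs-^ (f u) e))) ⟩
      + val q (∣ f u ∣ ^ e * ∣ M ∣)          ≡⟨ cong +_ (val-* q (∣ f u ∣ ^ e) ∣ M ∣) ⟩
      + (val q (∣ f u ∣ ^ e) + val q ∣ M ∣)  ≡⟨ cong (λ z → + (z + val q ∣ M ∣)) (val-^ q ∣ f u ∣ e) ⟩
      + (e * val q ∣ f u ∣) ℤ.+ + val q ∣ M ∣ ≡⟨ cong₂ ℤ._+_ (ℤ.pos-* e (val q ∣ f u ∣)) (val-monomial q us es) ⟩
      + e ℤ.* + val q ∣ f u ∣ ℤ.+ Σ· (Vec.map +_ es) (Vec.map (λ u → + val q ∣ f u ∣) us) ∎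
      where
      open ≡-Reasoning
      M = monomial f us es
      instance
        _ = f≢0 u
        _ = ℕ.m^n≢0 ∣ f u ∣ e
        _ = monomial-nonZero us es

  -- With `α` and `β` the valuations of numerators and denominators, the two brackets are the
  -- valuations of the two cross products of the monomials `es` and `fs`.
  Σ·-bilinear : ∀ (α β : X → ℕ) {n} (us : Vec X n) es fs →
    Σ· (Vec.zipWith ℤ._⊖_ es fs) (Vec.map (λ u → α u ℤ.⊖ β u) us) ≡
    (Σ· (Vec.map +_ es) (Vec.map (λ u → + α u) us) ℤ.+ Σ· (Vec.map +_ fs) (Vec.map (λ u → + β u) us)) ℤ.-
    (Σ· (Vec.map +_ es) (Vec.map (λ u → + β u) us) ℤ.+ Σ· (Vec.map +_ fs) (Vec.map (λ u → + α u) us))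
  Σ·-bilinear α β []       []       []       = refl
  Σ·-bilinear α β (u ∷ us) (e ∷ es) (f ∷ fs) = trans
    (cong₂ ℤ._+_ (sym (cong₂ ℤ._*_ (ℤ.m-n≡m⊖n e f) (ℤ.m-n≡m⊖n (α u) (β u)))) (Σ·-bilinear α β us es fs))
    (eq (+ e) (+ f) (+ α u) (+ β u) (Σ· E α⃗) (Σ· F β⃗) (Σ· E β⃗) (Σ· F α⃗))
    where
    E = Vec.map +_ es
    F = Vec.map +_ fs
    α⃗ = Vec.map (λ u → + α u) us
    β⃗ = Vec.map (λ u → + β u) us
    eq : ∀ e f a b S T V W → (e ℤ.- f) ℤ.* (a ℤ.- b) ℤ.+ ((S ℤ.+ T) ℤ.- (V ℤ.+ W)) ≡
      ((e ℤ.* a ℤ.+ S) ℤ.+ (f ℤ.* b ℤ.+ T)) ℤ.- ((e ℤ.* b ℤ.+ V) ℤ.+ (f ℤ.* a ℤ.+ W))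
    eq = solve-∀

  module _ (n : ℤ) where
    open Congruence n

    monomial-cong : ∀ {f g} → (∀ u → f u ≈ g u) → ∀ {m} (us : Vec X m) es → monomial f us es ≈ monomial g us es
    monomial-cong f≈g []       []       = ≈-refl
    monomial-cong f≈g (u ∷ us) (e ∷ es) = *-cong (^-cong e (f≈g u)) (monomial-cong f≈g us es)

zipWith-⊖≡0 : ∀ {n} (es fs : Vec ℕ n) → AllV.All (_≡ + 0) (Vec.zipWith ℤ._⊖_ es fs) → es ≡ fs
zipWith-⊖≡0 []       []       []         = refl
zipWith-⊖≡0 (e ∷ es) (f ∷ fs) (eq ∷ eqs) =
  cong₂ _∷_ (trans (sym (ℕ.+-identityʳ e)) (⊖≡⊖ e f 0 0 eq)) (zipWith-⊖≡0 es fs eqs)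

-- Cancellation, small representatives and heights modulo a prime

module _ {p : ℕ} (pr : Prime p) where

  open Congruence (+ p)

  ∣^⇒∣ : ∀ x n → + p Signed.∣ x ℤ.^ n → + p Signed.∣ x
  ∣^⇒∣ x zero    d = contradiction (subst Prime (ℕ.∣1⇒≡1 (∣⇒∣ᵤ d)) pr) ¬prime[1]
  ∣^⇒∣ x (suc n) d with euclidℤ pr x (x ℤ.^ n) d
  ... | inj₁ p∣x   = p∣x
  ... | inj₂ p∣x^n = ∣^⇒∣ x n p∣x^n

  ≈-cancelˡ : ∀ c {x y} → ¬ + p Signed.∣ c → c ℤ.* x ≈ c ℤ.* y → x ≈ y
  ≈-cancelˡ c {x} {y} p∤c (mod d) with euclidℤ pr c (x ℤ.- y) (subst (+ p Signed.∣_) (eq c x y) d)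
    where
    eq : ∀ c x y → c ℤ.* x ℤ.- c ℤ.* y ≡ c ℤ.* (x ℤ.- y)
    eq = solve-∀
  ... | inj₁ p∣c = contradiction p∣c p∤c
  ... | inj₂ d′  = mod d′

  ∤-pos : ∀ {b} → 1 ≤ b → b < p → ¬ + p Signed.∣ + b
  ∤-pos 1≤b b<p d = ℕ.<⇒≱ b<p (ℕ.∣⇒≤ {{>-nonZero 1≤b}} (∣⇒∣ᵤ d))

  ≈-small : ∀ N → 2 * N < p → ∀ {x y} → ∣ x ∣ ≤ N → ∣ y ∣ ≤ N → x ≈ y → x ≡ y
  ≈-small N 2N<p {x} {y} x≤N y≤N (mod d) with ∣ x ℤ.- y ∣ in eq
  ... | zero  = ℤ.i-j≡0⇒i≡j x y (ℤ.∣i∣≡0⇒i≡0 eq)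
  ... | suc m = contradiction (ℕ.∣⇒≤ (subst (p ∣_) eq (∣⇒∣ᵤ d))) (ℕ.<⇒≱ (begin-strict
    suc m         ≡⟨ eq ⟨
    ∣ x ℤ.- y ∣   ≤⟨ ℤ.∣i-j∣≤∣i∣+∣j∣ x y ⟩
    ∣ x ∣ + ∣ y ∣ ≤⟨ ℕ.+-mono-≤ x≤N y≤N ⟩
    N + N         ≡⟨ cong (_+_ N) (ℕ.+-identityʳ N) ⟨
    2 * N         <⟨ 2N<p ⟩
    p             ∎))
    where open ℕ.≤-Reasoning

  -- If B is a shortest representative of `y`, then B or -B represents `x` and has the same absolute
  -- value.
  IsIntHeight-≤ : ∀ {x y h h′} → IsIntHeight p x h → IsIntHeight p y h′ →
    + x ≈ + y ⊎ + x ≈ ℤ.- + y → h ≤ h′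
  IsIntHeight-≤ (_ , least) ((B , refl , B≡y) , _) (inj₁ x≈y) =
    least B (∣⇒∣ᵤ (difference (≈-trans {B} (mod (∣ᵤ⇒∣ B≡y)) (≈-sym x≈y))))
  IsIntHeight-≤ (_ , least) ((B , refl , B≡y) , _) (inj₂ x≈-y) =
    subst (_ ≤_) (ℤ.∣-i∣≡∣i∣ B)
      (least (ℤ.- B) (∣⇒∣ᵤ (difference (≈-trans (neg-cong {B} (mod (∣ᵤ⇒∣ B≡y))) (≈-sym x≈-y)))))

-- Fractions representing the elements of V(k,t,a)

primesUpTo : ℕ → List ℕ
primesUpTo k = filter prime? (upTo (suc k))

module FractionPoints (p t k a : ℕ) where

  open Congruence (+ p)

  -- The coset aG survives only through the equation satisfied by t-th powers, and the residue being
  -- nonzero only through the numerator being nonzero.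
  record Point : Set where
    field
      height residue denominator : ℕ
      numerator     : ℤ
      isIntHeight   : IsIntHeight p residue height
      denominator≥1 : 1 ≤ denominator
      denominator≤k : denominator ≤ k
      numerator≥1   : 1 ≤ ∣ numerator ∣
      numerator≤k   : ∣ numerator ∣ ≤ k
      fraction      : numerator ≈ + denominator ℤ.* + residue
      residue^t     : (+ residue) ℤ.^ t ≈ (+ a) ℤ.^ t

  open Point public

  exponent : Point → ℕ → ℤ
  exponent u q = val q ∣ numerator u ∣ ℤ.⊖ val q (denominator u)

module _ {p t k a : ℕ} (pr : Prime p) (k<p : k < p) where

  open Congruence (+ p)
  open FractionPoints p t k a

  point : 0 < t → 0 < a → a < p → ∀ {h} →
    ∃[ x ] (InV p k t a x × IsIntHeight p x h) → ∃[ u ] (height u ≡ h)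
  point 0<t 0<a a<p {h} (x , (x<p , (g , (_ , g^t≡1) , x≡ag) , (A , b , 1≤b , b≤k , A≤k , A≡bx)) , isHeight) = record
    { height = h ; residue = x ; denominator = b ; numerator = A
    ; isIntHeight = isHeight ; denominator≥1 = 1≤b ; denominator≤k = b≤k
    ; numerator≥1 = numerator≥1′ ; numerator≤k = A≤k
    ; fraction = A≈bx ; residue^t = x^t≈a^t } , refl
    where
    A≈bx : A ≈ + b ℤ.* + x
    A≈bx = ≈-trans {A} (mod (∣ᵤ⇒∣ A≡bx)) (≈-reflexive (ℤ.pos-* b x))
    x≈ag : + x ≈ + a ℤ.* + g
    x≈ag = ≈-trans {+ x} (mod (∣ᵤ⇒∣ x≡ag)) (≈-reflexive (ℤ.pos-* a g))
    g^t≈1 : (+ g) ℤ.^ t ≈ + 1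
    g^t≈1 = ≈-trans (≈-reflexive (sym (pos-^ g t))) (mod (∣ᵤ⇒∣ g^t≡1))
    x^t≈a^t : (+ x) ℤ.^ t ≈ (+ a) ℤ.^ t
    x^t≈a^t = ≈-trans (^-cong t x≈ag) (≈-trans (≈-reflexive (^-distrib-* (+ a) (+ g) t))
      (≈-trans (*-congˡ ((+ a) ℤ.^ t) g^t≈1) (≈-reflexive (ℤ.*-identityʳ ((+ a) ℤ.^ t)))))
    -- As t is positive, p dividing x would make p divide x^t, hence a^t and finally a, although 0 <
    -- a < p.
    p∤x : ¬ + p Signed.∣ + x
    p∤x p∣x = ∤-pos pr 0<a a<p (∣^⇒∣ pr (+ a) t (Signed.∣m+n∣m⇒∣n
      (subst (+ p Signed.∣_) (eq ((+ x) ℤ.^ t) ((+ a) ℤ.^ t)) (difference (≈-sym x^t≈a^t)))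
      (∣x^ t 0<t)))
      where
      eq : ∀ x a → a ℤ.- x ≡ ℤ.- x ℤ.+ a
      eq = solve-∀
      ∣x^ : ∀ t → 0 < t → + p Signed.∣ ℤ.- ((+ x) ℤ.^ t)
      ∣x^ (suc t) _ = Signed.∣m⇒∣-m (Signed.∣m⇒∣m*n ((+ x) ℤ.^ t) p∣x)
    numerator≥1′ : 1 ≤ ∣ A ∣
    numerator≥1′ = ℕ.n≢0⇒n>0 λ A≡0 → nonzero (subst (_≈ + b ℤ.* + x) (ℤ.∣i∣≡0⇒i≡0 A≡0) A≈bx)
      where
      nonzero : ¬ + 0 ≈ + b ℤ.* + x
      nonzero 0≈bx with euclidℤ pr (+ b) (+ x) (subst (+ p Signed.∣_) (ℤ.+-identityʳ (+ b ℤ.* + x)) (difference (≈-sym 0≈bx)))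
      ... | inj₁ p∣b = ∤-pos pr 1≤b (ℕ.≤-<-trans b≤k k<p) p∣b
      ... | inj₂ p∣x = p∤x p∣x

  -- Monomials in independent fractions

  module _ (2<p : 2 < p) {r : ℕ} (2k^2r≤p : 2 * k ^ (2 * r) ≤ p) where

    private
      -- The inequality is strict because p is odd and the left side is even.
      2k^2r<p : 2 * k ^ (2 * r) < p
      2k^2r<p = ℕ.≤∧≢⇒< 2k^2r≤p λ eq → 2∤p (subst (2 ∣_) eq (ℕ.m∣m*n (k ^ (2 * r))))
        where
        2∤p : ¬ 2 ∣ p
        2∤p 2∣p with prime⇒irreducible pr 2∣p
        ... | inj₂ 2≡p = ℕ.<⇒≢ 2<p 2≡p

      den : Point → ℤ
      den u = + denominator u

      res : Point → ℤ
      res u = + residue u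

    cross-bound : ∀ {n} (us : Vec Point n) es fs → Vec.sum es ≡ r → Vec.sum fs ≡ r →
      ∣ monomial numerator us es ℤ.* monomial den us fs ∣ ≤ k ^ (2 * r)
    cross-bound us es fs Σes≡r Σfs≡r = begin
      ∣ monomial numerator us es ℤ.* monomial den us fs ∣
        ≡⟨ ℤ.abs-* (monomial numerator us es) _ ⟩
      ∣ monomial numerator us es ∣ * ∣ monomial den us fs ∣
        ≤⟨ ℕ.*-mono-≤ (monomial-≤ numerator numerator≤k us es) (monomial-≤ den denominator≤k us fs) ⟩
      k ^ Vec.sum es * k ^ Vec.sum fs
        ≡⟨ cong₂ (λ m n → k ^ m * k ^ n) Σes≡r Σfs≡r ⟩
      k ^ r * k ^ r
        ≡⟨ ℕ.^-distribˡ-+-* k r r ⟨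
      k ^ (r + r)
        ≡⟨ cong (λ m → k ^ (r + m)) (ℕ.+-identityʳ r) ⟨
      k ^ (2 * r) ∎
      where open ℕ.≤-Reasoning

    monomial-fraction : ∀ {n} (us : Vec Point n) es →
      monomial numerator us es ≈ monomial den us es ℤ.* monomial res us es
    monomial-fraction us es = ≈-trans (monomial-cong (+ p) fraction us es) (≈-reflexive (monomial-* den res us es))

    -- Multiplying the congruence of the residues by both denominators makes the cross products
    -- congruent; both are at most k^(2r) in absolute value, so they coincide as integers.
    cross-≡ : ∀ {n} (us : Vec Point n) es fs → Vec.sum es ≡ r → Vec.sum fs ≡ r →
      monomial res us es ≈ monomial res us fs →
      monomial numerator us es ℤ.* monomial den us fs ≡ monomial numerator us fs ℤ.* monomial den us es
    cross-≡ us es fs Σes Σfs e≈f = ≈-small pr (k ^ (2 * r)) 2k^2r<p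
      (cross-bound us es fs Σes Σfs) (cross-bound us fs es Σfs Σes)
      (≈-trans (*-congʳ (D fs) (≈-trans (monomial-fraction us es) (*-congˡ (D es) e≈f)))
      (≈-trans (≈-reflexive (swap (D es) (monomial res us fs) (D fs)))
        (*-congʳ (D es) (≈-sym (monomial-fraction us fs)))))
      where
      D = monomial den us
      swap : ∀ x y z → x ℤ.* y ℤ.* z ≡ z ℤ.* y ℤ.* x
      swap = solve-∀

    -- Comparing valuations in the equality of cross products shows that `es` minus `fs` is a linear
    -- relation among the exponent vectors.
    monomials-distinct : ∀ {n} {us : Vec Point n} → Independent exponent us →
      ∀ {es fs} → Vec.sum es ≡ r → Vec.sum fs ≡ r → monomial res us es ≈ monomial res us fs → es ≡ fs
    monomials-distinct {us = us} indep {es} {fs} Σes Σfs e≈f =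
      zipWith-⊖≡0 es fs (indep _ λ q → trans
        (Σ·-bilinear (λ u → val q ∣ numerator u ∣) (λ u → val q (denominator u)) us es fs)
        (ℤ.i≡j⇒i-j≡0 (valuations q)))
      where
      open ≡-Reasoning
      num≢0 : ∀ u → NonZero ∣ numerator u ∣
      num≢0 u = >-nonZero (numerator≥1 u)
      den≢0 : ∀ u → NonZero (denominator u)
      den≢0 u = >-nonZero (denominator≥1 u)
      N D : Vec ℕ _ → ℤ
      N = monomial numerator us
      D = monomial den us
      val-cross : ∀ q es fs → val q ∣ N es ℤ.* D fs ∣ ≡ (val q ∣ N es ∣) + (val q ∣ D fs ∣)
      val-cross q es fs = trans (cong (val q) (ℤ.abs-* (N es) (D fs)))
        (val-* q ∣ N es ∣ ∣ D fs ∣ {{monomial-nonZero numerator num≢0 us es}} {{monomial-nonZero den den≢0 us fs}})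
      val-N : ∀ q es → + val q ∣ N es ∣ ≡ Σ· (Vec.map +_ es) (Vec.map (λ u → + val q ∣ numerator u ∣) us)
      val-N q = val-monomial numerator num≢0 q us
      val-D : ∀ q es → + val q ∣ D es ∣ ≡ Σ· (Vec.map +_ es) (Vec.map (λ u → + val q (denominator u)) us)
      val-D q = val-monomial den den≢0 q us
      valuations : ∀ q →
        Σ· (Vec.map +_ es) (Vec.map (λ u → + val q ∣ numerator u ∣) us) ℤ.+
        Σ· (Vec.map +_ fs) (Vec.map (λ u → + val q (denominator u)) us) ≡
        Σ· (Vec.map +_ es) (Vec.map (λ u → + val q (denominator u)) us) ℤ.+
        Σ· (Vec.map +_ fs) (Vec.map (λ u → + val q ∣ numerator u ∣) us)
      valuations q = begin
        _ ≡⟨ cong₂ ℤ._+_ (val-N q es) (val-D q fs) ⟨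
        + ((val q ∣ N es ∣) + (val q ∣ D fs ∣)) ≡⟨ cong +_ (val-cross q es fs) ⟨
        + val q ∣ N es ℤ.* D fs ∣ ≡⟨ cong (λ z → + val q ∣ z ∣) (cross-≡ us es fs Σes Σfs e≈f) ⟩
        + val q ∣ N fs ℤ.* D es ∣ ≡⟨ cong +_ (val-cross q fs es) ⟩
        + ((val q ∣ N fs ∣) + (val q ∣ D es ∣)) ≡⟨ cong +_ (ℕ.+-comm (val q ∣ N fs ∣) _) ⟩
        + ((val q ∣ D es ∣) + (val q ∣ N fs ∣)) ≡⟨ cong₂ ℤ._+_ (val-D q es) (val-N q fs) ⟩
        _ ∎

    independent⇒C≤t : 0 < t → ∀ {m} {us : Vec Point (suc m)} → Independent exponent us → ((r + m) C m) ≤ t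
    independent⇒C≤t (s≤s {n = t′} _) {m} {us} indep = begin
      (r + m) C m                                         ≡⟨ length-compositions m r ⟨
      length (compositions m r)                           ≡⟨ length-map (monomial res us) (compositions m r) ⟨
      length (map (monomial res us) (compositions m r))   ≤⟨ roots≤degree pr (^-minus-monic t′ c) distinct roots ⟩
      t                                                   ∎
      where
      open ℕ.≤-Reasoning
      -- All monomials have degree exactly `r`, and so they share this right-hand side and are roots
      -- of a single polynomial.
      c : ℤ
      c = ((+ a) ℤ.^ t) ℤ.^ r
      distinct : AllPairs (λ x y → ¬ y ≈ x) (map (monomial res us) (compositions m r))
      distinct = AllPairs.map⁺ (AllPairs-zip
        (λ Σes Σfs es≢fs f≈e → es≢fs (monomials-distinct indep Σes Σfs (≈-sym f≈e)))
        (compositions-sum m r) (compositions-unique m r))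
      root : ∀ {es} → Vec.sum es ≡ r → monomial res us es ℤ.^ t ≈ c
      root {es} refl = ≈-trans (≈-reflexive (monomial-^ res t us es))
        (≈-trans (monomial-cong (+ p) residue^t us es) (≈-reflexive (monomial-const ((+ a) ℤ.^ t) us es)))
      roots : All (λ x → + p Signed.∣ x ℤ.^ t ℤ.- c) (map (monomial res us) (compositions m r))
      roots = All.map⁺ (All.map (λ {es} Σes → difference (root {es} Σes)) (compositions-sum m r))

  -- Equal exponents give |A|d = |B|b, hence Ad = Bb or Ad = -Bb. As b and d are invertible modulo
  -- p, the residues agree up to sign.
  exponents-determine-height : ∀ u w → (∀ q → exponent u q ≡ exponent w q) → height u ≡ height w
  exponents-determine-height u w eq = ℕ.≤-antisym
    (IsIntHeight-≤ pr (isIntHeight u) (isIntHeight w) u≈±w)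
    (IsIntHeight-≤ pr (isIntHeight w) (isIntHeight u) (flip u≈±w))
    where
    A = numerator u
    B = numerator w
    b = denominator u
    d = denominator w
    x = + residue u
    y = + residue w
    instance
      _ = >-nonZero (numerator≥1 u)
      _ = >-nonZero (numerator≥1 w)
      _ = >-nonZero (denominator≥1 u)
      _ = >-nonZero (denominator≥1 w)
      _ = ℕ.m*n≢0 ∣ A ∣ d
      _ = ℕ.m*n≢0 ∣ B ∣ b
    Ad≡Bb : ∣ A ∣ * d ≡ ∣ B ∣ * b
    Ad≡Bb = val-injective _ _ λ q → trans (val-* q ∣ A ∣ d)
      (trans (⊖≡⊖ (val q ∣ A ∣) (val q b) (val q ∣ B ∣) (val q d) (eq q)) (sym (val-* q ∣ B ∣ b)))
    abs≡ : ∣ A ℤ.* + d ∣ ≡ ∣ B ℤ.* + b ∣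
    abs≡ = trans (ℤ.abs-* A (+ d)) (trans Ad≡Bb (sym (ℤ.abs-* B (+ b))))
    p∤bd : ¬ + p Signed.∣ + b ℤ.* + d
    p∤bd p∣bd with euclidℤ pr (+ b) (+ d) p∣bd
    ... | inj₁ p∣b = ∤-pos pr (denominator≥1 u) (ℕ.≤-<-trans (denominator≤k u) k<p) p∣b
    ... | inj₂ p∣d = ∤-pos pr (denominator≥1 w) (ℕ.≤-<-trans (denominator≤k w) k<p) p∣d
    bdx≈Ad : (+ b ℤ.* + d) ℤ.* x ≈ A ℤ.* + d
    bdx≈Ad = ≈-trans (≈-reflexive (swap (+ b) (+ d) x)) (*-congʳ (+ d) (≈-sym (fraction u)))
      where
      swap : ∀ b d x → b ℤ.* d ℤ.* x ≡ b ℤ.* x ℤ.* d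
      swap = solve-∀
    bdy≈Bb : (+ b ℤ.* + d) ℤ.* y ≈ B ℤ.* + b
    bdy≈Bb = ≈-trans (≈-reflexive (swap (+ b) (+ d) y)) (*-congʳ (+ b) (≈-sym (fraction w)))
      where
      swap : ∀ b d x → b ℤ.* d ℤ.* x ≡ d ℤ.* x ℤ.* b
      swap = solve-∀
    u≈±w : x ≈ y ⊎ x ≈ ℤ.- y
    u≈±w with abs-≡ _ _ abs≡
    ... | inj₁ e = inj₁ (≈-cancelˡ pr (+ b ℤ.* + d) p∤bd
      (≈-trans bdx≈Ad (≈-trans (≈-reflexive e) (≈-sym bdy≈Bb))))
    ... | inj₂ e = inj₂ (≈-cancelˡ pr (+ b ℤ.* + d) p∤bd
      (≈-trans bdx≈Ad (≈-trans (≈-reflexive e) (≈-trans (neg-cong (≈-sym bdy≈Bb))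
        (≈-reflexive (ℤ.neg-distribʳ-* (+ b ℤ.* + d) y))))))
    flip : x ≈ y ⊎ x ≈ ℤ.- y → y ≈ x ⊎ y ≈ ℤ.- x
    flip (inj₁ e) = inj₁ (≈-sym e)
    flip (inj₂ e) = inj₂ (≈-trans (≈-reflexive (sym (ℤ.neg-involutive y))) (neg-cong (≈-sym e)))

  -- Counting heights by codes

  exponent-zero : ∀ u q → ¬ q ∈ primesUpTo k → exponent u q ≡ + 0
  exponent-zero u q q∉ = cong₂ ℤ._⊖_
    (val-zero (numerator≥1 u) (numerator≤k u)) (val-zero (denominator≥1 u) (denominator≤k u))
    where
    val-zero : ∀ {n} → 1 ≤ n → n ≤ k → val q n ≡ 0
    val-zero {n} 1≤n n≤k with val q n ℕ.≟ 0
    ... | yes v≡0 = v≡0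
    ... | no  v≢0 with val≢0⇒prime-divisor q n v≢0
    ...   | q-prime , q∣n = contradiction
      (∈-filter⁺ prime? (∈-upTo⁺ (s≤s (ℕ.≤-trans (ℕ.∣⇒≤ {{>-nonZero 1≤n}} q∣n) n≤k))) q-prime) q∉

  separated⇒bound : ∀ {U qs n} → qs ⊆ primesUpTo k → length qs ≤ n → Separates exponent U qs (primesUpTo k) →
    ∀ {hs} → Unique hs → (∀ {h} → h ∈ hs → ∃[ u ] (u ∈ U × height u ≡ h)) → length hs ≤ Φ̃ k n
  separated⇒bound {U} {qs} {n} qs⊆ len sep {hs} unique lift = begin
    length hs                         ≤⟨ pigeonhole R R-injective unique (codes k 0 0 (length qs)) R-total ⟩
    length (codes k 0 0 (length qs))  ≡⟨ length-codes k 0 0 (length qs) ⟩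
    wordSum (ΨΨ k) 0 0 (length qs)    ≤⟨ wordSum≤Φ̃ k len ⟩
    Φ̃ k n                             ∎
    where
    open ℕ.≤-Reasoning
    code : Point → Code
    code u = encode (map (exponent u) qs) 0 0 1 1
    -- A relation avoids choosing one point per height: any point of `U` with that height will do,
    -- as only the way back from codes to heights must be single-valued.
    R : ℕ → Code → Set
    R h c = ∃[ u ] (u ∈ U × height u ≡ h × code u ≡ c)
    qs-prime : All Prime qs
    qs-prime = All-resp-⊆ qs⊆ (All.all-filter prime? (upTo (suc k)))
    qs-ascending : AllPairs _<_ qs
    qs-ascending = AllPairs-resp-⊆ qs⊆ (AllPairs.filter⁺ prime? (AllPairs.applyUpTo⁺₁ (λ i → i) (suc k) λ i<j _ → i<j))
    qs>1 : All (1 <_) qs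
    qs>1 = All.map (λ q-prime → nonTrivial⇒n>1 _ {{prime⇒nonTrivial q-prime}}) qs-prime
    -- With p_0 = 1 the accumulators can start at 1 for `i = j = 0`, and every prime exceeds p_0.
    Smooth-1 : Smooth 1 1
    Smooth-1 _ q∣1 = ℕ.∣⇒≤ q∣1
    part≤ : ∀ (f : ℕ → ℕ) {n} → 1 ≤ n → n ≤ k → (∀ q → f q ≤ val q n) → 1 * Π^ qs f ≤ k
    part≤ f {n} 1≤n n≤k f≤ = begin
      1 * Π^ qs f            ≡⟨ ℕ.*-identityˡ _ ⟩
      Π^ qs f                ≤⟨ Π^-mono qs (All.map prime⇒nonZero qs-prime) f≤ ⟩
      Π^ qs (λ q → val q n)  ≤⟨ Π^-val qs (AllPairs.map ℕ.<⇒≢ qs-ascending) n {{>-nonZero 1≤n}} ⟩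
      n                      ≤⟨ n≤k ⟩
      k                      ∎
    code-∈ : ∀ u → code u ∈ codes k 0 0 (length qs)
    code-∈ u = encode-∈ k (exponent u) qs-prime qs-ascending 0 0 1 1 qs>1 qs>1 Smooth-1 Smooth-1
      (part≤ (λ q → exponent u q ⁺) (numerator≥1 u) (numerator≤k u) λ q → ⊖⁺≤ (val q ∣ numerator u ∣) (val q (denominator u)))
      (part≤ (λ q → exponent u q ⁻) (denominator≥1 u) (denominator≤k u) λ q → ⊖⁻≤ (val q ∣ numerator u ∣) (val q (denominator u)))
    R-total : ∀ {h} → h ∈ hs → ∃[ c ] (c ∈ codes k 0 0 (length qs) × R h c)
    R-total h∈ with lift h∈
    ... | u , u∈U , refl = code u , code-∈ u , u , u∈U , refl , refl
    map-≡⇒All : ∀ {e e′ : ℕ → ℤ} qs → map e qs ≡ map e′ qs → All (λ q → e q ≡ e′ q) qs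
    map-≡⇒All []       _  = []
    map-≡⇒All (q ∷ qs) eq = ∷-injectiveˡ eq ∷ map-≡⇒All qs (∷-injectiveʳ eq)
    R-injective : ∀ {h h′ c} → R h c → R h′ c → h ≡ h′
    R-injective (u , u∈U , refl , refl) (w , w∈U , refl , eq) = exponents-determine-height u w agree
      where
      on-primes : All (λ q → exponent u q ≡ exponent w q) (primesUpTo k)
      on-primes = sep u∈U w∈U (map-≡⇒All qs (proj₁
        (encode-injective (map (exponent u) qs) (map (exponent w) qs) 0 0 {1} {1} {1} {1} Smooth-1 Smooth-1 Smooth-1 Smooth-1 (sym eq))))
      agree : ∀ q → exponent u q ≡ exponent w q
      agree q with q ∈? primesUpTo k
      ... | yes q∈ = All.lookup on-primes q∈
      ... | no  q∉ = trans (exponent-zero u q q∉) (sym (exponent-zero w q q∉))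

-- The dichotomy for the rank of the exponent vectors

theorem1p5 : (p t k a r s : ℕ) → Prime p → 2 < p → t ∣ (p ∸ 1) → 0 < t →
    1 < k → 2 * (k * k) ≤ p → 0 < a → a < p → IsR1 p k r → IsS1 r t s →
    (hs : List ℕ) → Unique hs →
    All (λ h → ∃[ x ] (InV p k t a x × IsIntHeight p x h)) hs →
    length hs ≤ Φ̃ k (suc s)
theorem1p5 p t k a r s pr 2<p _ 0<t 1<k 2k²≤p 0<a a<p (2k^2r≤p , _) (_ , s-max) hs unique vs =
  bound (preimages (All.map (point pr k<p 0<t 0<a a<p) vs))
  where
  open FractionPoints p t k a
  k<p : k < p
  k<p = ℕ.<-≤-trans (begin-strict
    k           ≡⟨ ℕ.*-identityʳ k ⟨
    k * 1       <⟨ ℕ.*-monoʳ-< k {{>-nonZero (ℕ.<⇒≤ 1<k)}} 1<k ⟩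
    k * k       ≤⟨ ℕ.m≤m+n (k * k) _ ⟩
    2 * (k * k) ∎) 2k²≤p
    where open ℕ.≤-Reasoning
  bound : ∃[ U ] (∀ {h} → h ∈ hs → ∃[ u ] (u ∈ U × height u ≡ h)) → length hs ≤ Φ̃ k (suc s)
  -- The parameter is s + 1: the first outcome has s + 2 independent points, the second at most s +
  -- 1 pivot primes.
  bound (U , lift) with eliminate (suc s) exponent U (primesUpTo k)
  ... | inj₁ (us , indep) = contradiction
    (s-max (suc s) (independent⇒C≤t pr k<p 2<p {r} 2k^2r≤p 0<t {suc s} {us} indep)) (ℕ.<-irrefl refl)
  ... | inj₂ (qs , qs⊆ , len , sep) =
    separated⇒bound pr k<p {U} {qs} {suc s} qs⊆ len sep unique lift
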